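{- For all $n\ge d$ (with $d\ge1$) and $0\le\varepsilon<1$, $$2^{d-1}\le A(n,d)\le A^+(n,d)\le A^\varepsilon(n,d).$$
   Context: For a homogeneous polynomial $g\in\mathbb{C}[x_1,\ldots,x_n]_d$, the Waring rank $\mathbf{R}(g)$ is the minimum $r$ such that $g=\ell_1^d+\cdots+\ell_r^d$ for some linear forms $\ell_i\in\mathbb{C}[x_1,\ldots,x_n]_1$. For $f=\sum_\alpha c_\alpha x^\alpha$, $\mathrm{supp}(f)=\{\alpha: c_\alpha\neq0\}$, and $e_{n,d}=\sum_{1\le i_1<\cdots<i_d\le n}x_{i_1}\cdots x_{i_d}$. $A(n,d)$ is the minimum of $\mathbf{R}(g)$ over $g\in\mathbb{C}[x_1,\ldots,x_n]_d$ with $\mathrm{supp}(g)=\mathrm{supp}(e_{n,d})$; $A^+(n,d)$ is the minimum over such $g$ with nonnegative real coefficients; $A^\varepsilon(n,d)$ is the minimum over such $g$ with real coefficients all of whose nonzero coefficients lie in $[1-\varepsilon,1+\varepsilon]$. -}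

module Defs where

open import Level using (0ℓ)
open import Algebra.Bundles using (CommutativeMonoid; RawRing; RawSemiring)
import Algebra.Definitions.RawMonoid as RawMonoidDefs
import Algebra.Definitions.RawSemiring as RawSemiringDefs
import Algebra.Properties.CommutativeSemigroup as CommutativeSemigroupProperties
open import Data.Bool.Base using (if_then_else_)
open import Data.Fin.Base using (Fin; toℕ)
open import Data.Fin.Subset using (Subset; inside; outside; ∣_∣)
open import Data.List.Base as List using (List; _++_; filter)
open import Data.Nat.Base as ℕ using (ℕ; zero; suc; _∸_; _⊔_)
import Data.Nat.Properties as ℕ
open import Data.Product.Base using (∃; _×_; _,_; proj₁; proj₂)
open import Data.Rational.Base as ℚ using (ℚ; 0ℚ; 1ℚ; ½; Positive)
import Data.Rational.Properties as ℚ
open import Data.Vec.Base as Vec using (Vec; []; _∷_)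
open import Data.Vec.Properties using (≡-dec)
open import Relation.Binary.Core using (Rel)
open import Relation.Binary.PropositionalEquality
open import Relation.Nullary.Decidable using (does)
open import Relation.Nullary.Negation using (¬_)
open import Relation.Unary using (Pred; _≐_; _∈_)

open CommutativeSemigroupProperties
  (CommutativeMonoid.commutativeSemigroup ℚ.+-0-commutativeMonoid) using (interchange)

-- The reals are Cauchy sequences of rationals, taken up to null sequences.

Eventually : Pred ℕ 0ℓ → Set
Eventually P = ∃ λ N → ∀ n → N ℕ.≤ n → P n

Cauchy : (ℕ → ℚ) → Set
Cauchy x = ∀ ε → 0ℚ ℚ.< ε →
  ∃ λ N → ∀ m n → N ℕ.≤ m → N ℕ.≤ n → ℚ.∣ x m ℚ.- x n ∣ ℚ.< ε

record ℝ : Set where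
  constructor mkℝ
  field
    seq    : ℕ → ℚ
    cauchy : Cauchy seq

open ℝ public

infix 4 _≈ᴿ_ _≤ᴿ_ _<ᴿ_

_≈ᴿ_ : Rel ℝ 0ℓ
x ≈ᴿ y = ∀ ε → 0ℚ ℚ.< ε → Eventually λ n → ℚ.∣ seq x n ℚ.- seq y n ∣ ℚ.< ε

_≤ᴿ_ : Rel ℝ 0ℓ
x ≤ᴿ y = ∀ ε → 0ℚ ℚ.< ε → Eventually λ n → seq x n ℚ.< seq y n ℚ.+ ε

_<ᴿ_ : Rel ℝ 0ℓ
x <ᴿ y = ∃ λ ε → 0ℚ ℚ.< ε × Eventually λ n → seq x n ℚ.+ ε ℚ.< seq y n

abstract

  telescope : ∀ p q r → (p ℚ.- q) ℚ.+ (q ℚ.- r) ≡ p ℚ.- r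
  telescope p q r = begin
    (p ℚ.- q) ℚ.+ (q ℚ.- r)        ≡⟨ ℚ.+-assoc p (ℚ.- q) (q ℚ.- r) ⟩
    p ℚ.+ (ℚ.- q ℚ.+ (q ℚ.- r))    ≡⟨ cong (p ℚ.+_) (ℚ.+-assoc (ℚ.- q) q (ℚ.- r)) ⟨
    p ℚ.+ ((ℚ.- q ℚ.+ q) ℚ.- r)    ≡⟨ cong (λ z → p ℚ.+ (z ℚ.- r)) (ℚ.+-inverseˡ q) ⟩
    p ℚ.+ (0ℚ ℚ.- r)               ≡⟨ cong (p ℚ.+_) (ℚ.+-identityˡ (ℚ.- r)) ⟩
    p ℚ.- r                        ∎
    where open ≡-Reasoning

  add-sub : ∀ p q → p ≡ (p ℚ.- q) ℚ.+ q
  add-sub p q = sym (begin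
    (p ℚ.- q) ℚ.+ q       ≡⟨ ℚ.+-assoc p (ℚ.- q) q ⟩
    p ℚ.+ (ℚ.- q ℚ.+ q)   ≡⟨ cong (p ℚ.+_) (ℚ.+-inverseˡ q) ⟩
    p ℚ.+ 0ℚ              ≡⟨ ℚ.+-identityʳ p ⟩
    p                     ∎)
    where open ≡-Reasoning

  const-cauchy : ∀ q → Cauchy (λ _ → q)
  const-cauchy q ε ε>0 = 0 , λ _ _ _ _ →
    subst (λ z → ℚ.∣ z ∣ ℚ.< ε) (sym (ℚ.+-inverseʳ q)) ε>0

  neg-cauchy : ∀ x → Cauchy x → Cauchy (λ n → ℚ.- x n)
  neg-cauchy x cx ε ε>0 = proj₁ (cx ε ε>0) , λ m n N≤m N≤n →
    subst (ℚ._< ε) (begin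
      ℚ.∣ x m ℚ.- x n ∣              ≡⟨ ℚ.∣-p∣≡∣p∣ (x m ℚ.- x n) ⟨
      ℚ.∣ ℚ.- (x m ℚ.- x n) ∣        ≡⟨ cong ℚ.∣_∣ (ℚ.neg-distrib-+ (x m) (ℚ.- x n)) ⟩
      ℚ.∣ ℚ.- x m ℚ.- ℚ.- x n ∣      ∎)
      (proj₂ (cx ε ε>0) m n N≤m N≤n)
    where open ≡-Reasoning

  +-cauchy : ∀ x y → Cauchy x → Cauchy y → Cauchy (λ n → x n ℚ.+ y n)
  +-cauchy x y cx cy ε ε>0
    with N₁ , h₁ ← cx (½ ℚ.* ε) (ℚ.*-monoʳ-<-pos ½ ε>0)
       | N₂ , h₂ ← cy (½ ℚ.* ε) (ℚ.*-monoʳ-<-pos ½ ε>0)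
    = N₁ ⊔ N₂ , λ m n N≤m N≤n → begin-strict
      ℚ.∣ (x m ℚ.+ y m) ℚ.- (x n ℚ.+ y n) ∣
        ≡⟨ cong ℚ.∣_∣ (trans
             (cong (x m ℚ.+ y m ℚ.+_) (ℚ.neg-distrib-+ (x n) (y n)))
             (interchange (x m) (y m) (ℚ.- x n) (ℚ.- y n))) ⟩
      ℚ.∣ (x m ℚ.- x n) ℚ.+ (y m ℚ.- y n) ∣
        ≤⟨ ℚ.∣p+q∣≤∣p∣+∣q∣ (x m ℚ.- x n) (y m ℚ.- y n) ⟩
      ℚ.∣ x m ℚ.- x n ∣ ℚ.+ ℚ.∣ y m ℚ.- y n ∣
        <⟨ ℚ.+-mono-< (h₁ m n (ℕ.m⊔n≤o⇒m≤o N₁ N₂ N≤m) (ℕ.m⊔n≤o⇒m≤o N₁ N₂ N≤n))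
                      (h₂ m n (ℕ.m⊔n≤o⇒n≤o N₁ N₂ N≤m) (ℕ.m⊔n≤o⇒n≤o N₁ N₂ N≤n)) ⟩
      ½ ℚ.* ε ℚ.+ ½ ℚ.* ε
        ≡⟨ ℚ.*-distribʳ-+ ε ½ ½ ⟨
      1ℚ ℚ.* ε
        ≡⟨ ℚ.*-identityˡ ε ⟩
      ε ∎
    where open ℚ.≤-Reasoning

  cauchy⇒bounded : ∀ x → Cauchy x →
    ∃ λ B → Positive B × Eventually λ n → ℚ.∣ x n ∣ ℚ.≤ B
  cauchy⇒bounded x cx with N , h ← cx 1ℚ (ℚ.positive⁻¹ 1ℚ) =
    1ℚ ℚ.+ ℚ.∣ x N ∣ ,
    ℚ.positive (ℚ.+-mono-<-≤ (ℚ.positive⁻¹ 1ℚ) (ℚ.0≤∣p∣ (x N))) ,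
    N , λ n N≤n → begin
      ℚ.∣ x n ∣                          ≡⟨ cong ℚ.∣_∣ (add-sub (x n) (x N)) ⟩
      ℚ.∣ (x n ℚ.- x N) ℚ.+ x N ∣        ≤⟨ ℚ.∣p+q∣≤∣p∣+∣q∣ (x n ℚ.- x N) (x N) ⟩
      ℚ.∣ x n ℚ.- x N ∣ ℚ.+ ℚ.∣ x N ∣    ≤⟨ ℚ.+-monoˡ-≤ ℚ.∣ x N ∣
                                              (ℚ.<⇒≤ (h n N N≤n ℕ.≤-refl)) ⟩
      1ℚ ℚ.+ ℚ.∣ x N ∣                   ∎
    where open ℚ.≤-Reasoning

  divide : ∀ D → Positive D → ∀ ε → 0ℚ ℚ.< ε → ∃ λ δ → 0ℚ ℚ.< δ × D ℚ.* δ ≡ ε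
  divide D D>0 ε ε>0 =
    D⁻¹ ℚ.* ε ,
    ℚ.positive⁻¹ (D⁻¹ ℚ.* ε) {{ℚ.pos*pos⇒pos D⁻¹ {{ℚ.1/pos⇒pos D {{D>0}}}} ε {{ℚ.positive ε>0}}}} ,
    (begin
      D ℚ.* (D⁻¹ ℚ.* ε)   ≡⟨ ℚ.*-assoc D D⁻¹ ε ⟨
      D ℚ.* D⁻¹ ℚ.* ε     ≡⟨ cong (ℚ._* ε) (ℚ.*-inverseʳ D {{ℚ.pos⇒nonZero D {{D>0}}}}) ⟩
      1ℚ ℚ.* ε            ≡⟨ ℚ.*-identityˡ ε ⟩
      ε                   ∎)
    where
    open ≡-Reasoning

    D⁻¹ : ℚ
    D⁻¹ = (ℚ.1/ D) {{ℚ.pos⇒nonZero D {{D>0}}}}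

  scale : ∀ {E δ} → Positive E → ∀ a b → ℚ.∣ a ∣ ℚ.≤ E → ℚ.∣ b ∣ ℚ.< δ →
          ℚ.∣ a ℚ.* b ∣ ℚ.< E ℚ.* δ
  scale {E} {δ} E>0 a b a≤ b< = begin-strict
    ℚ.∣ a ℚ.* b ∣           ≡⟨ ℚ.∣p*q∣≡∣p∣*∣q∣ a b ⟩
    ℚ.∣ a ∣ ℚ.* ℚ.∣ b ∣     ≤⟨ ℚ.*-monoʳ-≤-nonNeg ℚ.∣ b ∣ {{ℚ.∣-∣-nonNeg b}} a≤ ⟩
    E ℚ.* ℚ.∣ b ∣           <⟨ ℚ.*-monoʳ-<-pos E {{E>0}} b< ⟩
    E ℚ.* δ                 ∎
    where open ℚ.≤-Reasoning

  distrib : ∀ a b c → a ℚ.* (b ℚ.- c) ≡ a ℚ.* b ℚ.- a ℚ.* c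
  distrib a b c = trans (ℚ.*-distribˡ-+ a b (ℚ.- c))
                        (cong (a ℚ.* b ℚ.+_) (sym (ℚ.neg-distribʳ-* a c)))

  split : ∀ a b c d → a ℚ.* b ℚ.- c ℚ.* d ≡ a ℚ.* (b ℚ.- d) ℚ.+ d ℚ.* (a ℚ.- c)
  split a b c d = sym (begin
    a ℚ.* (b ℚ.- d) ℚ.+ d ℚ.* (a ℚ.- c)
      ≡⟨ cong₂ ℚ._+_ (distrib a b d) (distrib d a c) ⟩
    (a ℚ.* b ℚ.- a ℚ.* d) ℚ.+ (d ℚ.* a ℚ.- d ℚ.* c)
      ≡⟨ cong₂ (λ p q → (a ℚ.* b ℚ.- a ℚ.* d) ℚ.+ (p ℚ.- q)) (ℚ.*-comm d a) (ℚ.*-comm d c) ⟩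
    (a ℚ.* b ℚ.- a ℚ.* d) ℚ.+ (a ℚ.* d ℚ.- c ℚ.* d)
      ≡⟨ telescope (a ℚ.* b) (a ℚ.* d) (c ℚ.* d) ⟩
    a ℚ.* b ℚ.- c ℚ.* d ∎)
    where open ≡-Reasoning

  product-close : ∀ {B C δ} → Positive B → Positive C → ∀ a b c d →
    ℚ.∣ a ∣ ℚ.≤ B → ℚ.∣ d ∣ ℚ.≤ C → ℚ.∣ a ℚ.- c ∣ ℚ.< δ → ℚ.∣ b ℚ.- d ∣ ℚ.< δ →
    ℚ.∣ a ℚ.* b ℚ.- c ℚ.* d ∣ ℚ.< (B ℚ.+ C) ℚ.* δ
  product-close {B} {C} {δ} B>0 C>0 a b c d a≤B d≤C ac<δ bd<δ = begin-strict
    ℚ.∣ a ℚ.* b ℚ.- c ℚ.* d ∣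
      ≡⟨ cong ℚ.∣_∣ (split a b c d) ⟩
    ℚ.∣ a ℚ.* (b ℚ.- d) ℚ.+ d ℚ.* (a ℚ.- c) ∣
      ≤⟨ ℚ.∣p+q∣≤∣p∣+∣q∣ (a ℚ.* (b ℚ.- d)) (d ℚ.* (a ℚ.- c)) ⟩
    ℚ.∣ a ℚ.* (b ℚ.- d) ∣ ℚ.+ ℚ.∣ d ℚ.* (a ℚ.- c) ∣
      <⟨ ℚ.+-mono-< (scale B>0 a (b ℚ.- d) a≤B bd<δ) (scale C>0 d (a ℚ.- c) d≤C ac<δ) ⟩
    B ℚ.* δ ℚ.+ C ℚ.* δ
      ≡⟨ ℚ.*-distribʳ-+ δ B C ⟨
    (B ℚ.+ C) ℚ.* δ ∎
    where open ℚ.≤-Reasoning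

  *-cauchy : ∀ x y → Cauchy x → Cauchy y → Cauchy (λ n → x n ℚ.* y n)
  *-cauchy x y cx cy ε ε>0 =
    let B , B>0 , M₁ , b₁ = cauchy⇒bounded x cx
        C , C>0 , M₂ , b₂ = cauchy⇒bounded y cy
        δ , δ>0 , [B+C]δ≡ε = divide (B ℚ.+ C) (ℚ.pos+pos⇒pos B {{B>0}} C {{C>0}}) ε ε>0
        N₁ , h₁ = cx δ δ>0
        N₂ , h₂ = cy δ δ>0
    in (M₁ ⊔ M₂) ⊔ (N₁ ⊔ N₂) , λ m n N≤m N≤n →
      let Mm = ℕ.m⊔n≤o⇒m≤o (M₁ ⊔ M₂) (N₁ ⊔ N₂) N≤m
          Mn = ℕ.m⊔n≤o⇒m≤o (M₁ ⊔ M₂) (N₁ ⊔ N₂) N≤n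
          Nm = ℕ.m⊔n≤o⇒n≤o (M₁ ⊔ M₂) (N₁ ⊔ N₂) N≤m
          Nn = ℕ.m⊔n≤o⇒n≤o (M₁ ⊔ M₂) (N₁ ⊔ N₂) N≤n
      in subst (ℚ.∣ x m ℚ.* y m ℚ.- x n ℚ.* y n ∣ ℚ.<_) [B+C]δ≡ε
           (product-close B>0 C>0 (x m) (y m) (x n) (y n)
             (b₁ m (ℕ.m⊔n≤o⇒m≤o M₁ M₂ Mm))
             (b₂ n (ℕ.m⊔n≤o⇒n≤o M₁ M₂ Mn))
             (h₁ m n (ℕ.m⊔n≤o⇒m≤o N₁ N₂ Nm) (ℕ.m⊔n≤o⇒m≤o N₁ N₂ Nn))
             (h₂ m n (ℕ.m⊔n≤o⇒n≤o N₁ N₂ Nm) (ℕ.m⊔n≤o⇒n≤o N₁ N₂ Nn)))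

infixl 6 _+ᴿ_ _-ᴿ_
infixl 7 _*ᴿ_
infix  8 -ᴿ_

fromℚ : ℚ → ℝ
fromℚ q = mkℝ (λ _ → q) (const-cauchy q)

0ᴿ 1ᴿ : ℝ
0ᴿ = fromℚ 0ℚ
1ᴿ = fromℚ 1ℚ

_+ᴿ_ : ℝ → ℝ → ℝ
x +ᴿ y = mkℝ (λ n → seq x n ℚ.+ seq y n) (+-cauchy (seq x) (seq y) (cauchy x) (cauchy y))

_*ᴿ_ : ℝ → ℝ → ℝ
x *ᴿ y = mkℝ (λ n → seq x n ℚ.* seq y n) (*-cauchy (seq x) (seq y) (cauchy x) (cauchy y))

-ᴿ_ : ℝ → ℝ
-ᴿ x = mkℝ (λ n → ℚ.- seq x n) (neg-cauchy (seq x) (cauchy x))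

_-ᴿ_ : ℝ → ℝ → ℝ
x -ᴿ y = x +ᴿ (-ᴿ y)

record ℂ : Set where
  constructor _+i_
  field
    re im : ℝ

open ℂ public

ℂ-rawRing : RawRing 0ℓ 0ℓ
ℂ-rawRing = record
  { Carrier = ℂ
  ; _≈_     = λ z w → re z ≈ᴿ re w × im z ≈ᴿ im w
  ; _+_     = λ z w → (re z +ᴿ re w) +i (im z +ᴿ im w)
  ; _*_     = λ z w → (re z *ᴿ re w -ᴿ im z *ᴿ im w) +i (re z *ᴿ im w +ᴿ im z *ᴿ re w)
  ; -_      = λ z → (-ᴿ re z) +i (-ᴿ im z)
  ; 0#      = 0ᴿ +i 0ᴿ
  ; 1#      = 1ᴿ +i 0ᴿ
  }

module ℂᴿ = RawRing ℂ-rawRing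
open ℂᴿ public using () renaming
  (_≈_ to _≈ᶜ_; _+_ to _+ᶜ_; _*_ to _*ᶜ_; -_ to -ᶜ_; 0# to 0ᶜ; 1# to 1ᶜ)
open RawMonoidDefs ℂᴿ.+-rawMonoid public using () renaming (sum to sumᶜ)

IsReal : Pred ℂ 0ℓ
IsReal z = im z ≈ᴿ 0ᴿ

-- Power series ∑ c_α x^α in x₁,…,xₙ, as coefficient functions.
-- Polynomials are those with finitely many nonzero coefficients; below
-- only homogeneous ones occur, for which finiteness is automatic.

Exponent : ℕ → Set
Exponent n = Vec ℕ n

Series : ℕ → Set
Series n = Exponent n → ℂ

-- ∑⟨ α ⟩ F is the sum of F β γ over all pairs with β + γ = α.

∑⟨_⟩ : ∀ {n} → Exponent n → (Exponent n → Exponent n → ℂ) → ℂ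
∑⟨ [] ⟩    F = F [] []
∑⟨ a ∷ α ⟩ F = sumᶜ {suc a} λ i → ∑⟨ α ⟩ λ β γ → F (toℕ i ∷ β) ((a ∸ toℕ i) ∷ γ)

x^_ : ∀ {n} → Exponent n → Series n
(x^ α) β = if does (≡-dec ℕ._≟_ α β) then 1ᶜ else 0ᶜ

series-rawSemiring : ℕ → RawSemiring 0ℓ 0ℓ
series-rawSemiring n = record
  { Carrier = Series n
  ; _≈_     = λ f g → ∀ α → f α ≈ᶜ g α
  ; _+_     = λ f g α → f α +ᶜ g α
  ; _*_     = λ f g α → ∑⟨ α ⟩ λ β γ → f β *ᶜ g γ
  ; 0#      = λ _ → 0ᶜ
  ; 1#      = x^ Vec.replicate n 0
  }

module _ {n : ℕ} where
  open RawSemiring (series-rawSemiring n) public using () renaming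
    (_≈_ to _≈ˢ_; _+_ to _+ˢ_; _*_ to _*ˢ_; 0# to 0ˢ; 1# to 1ˢ)
  open RawSemiringDefs (series-rawSemiring n) public using () renaming
    (sum to sumˢ; _^_ to _^ˢ_)

supp : ∀ {n} → Series n → Pred (Exponent n) 0ℓ
supp f α = ¬ (f α ≈ᶜ 0ᶜ)

-- ℂ[x₁,…,xₙ]_d
record Form (n d : ℕ) : Set where
  field
    coeff       : Series n
    homogeneous : ∀ α → Vec.sum α ≢ d → coeff α ≈ᶜ 0ᶜ

open Form public

subsets : ∀ n → List (Subset n)
subsets zero    = List.[ [] ]
subsets (suc n) = List.map (inside ∷_) (subsets n) ++ List.map (outside ∷_) (subsets n)

indicator : ∀ {n} → Subset n → Exponent n
indicator = Vec.map λ s → if s then 1 else 0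

e : ∀ n d → Series n
e n d = List.foldr _+ˢ_ 0ˢ
  (List.map (λ S → x^ indicator S) (filter (λ S → ∣ S ∣ ℕ.≟ d) (subsets n)))

IsMinimum : Pred ℕ 0ℓ → Pred ℕ 0ℓ
IsMinimum P m = P m × (∀ k → P k → m ℕ.≤ k)

HasWaringDecomposition : ∀ {n d} → Form n d → Pred ℕ 0ℓ
HasWaringDecomposition {n} {d} g r =
  ∃ λ (ℓ : Fin r → Form n 1) → coeff g ≈ˢ sumˢ λ i → coeff (ℓ i) ^ˢ d

-- WaringRank g r says that R(g) exists and equals r; the predicates IsA, IsA⁺
-- and IsAᵋ treat the minima A(n,d), A⁺(n,d) and A^ε(n,d) in the same way.
WaringRank : ∀ {n d} → Form n d → Pred ℕ 0ℓ
WaringRank g = IsMinimum (HasWaringDecomposition g)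

NonNegativeCoefficients : ∀ {n d} → Pred (Form n d) 0ℓ
NonNegativeCoefficients g = ∀ α → IsReal (coeff g α) × 0ᴿ ≤ᴿ re (coeff g α)

CoefficientsNear1 : ∀ {n d} → ℝ → Pred (Form n d) 0ℓ
CoefficientsNear1 ε g =
  (∀ α → IsReal (coeff g α)) ×
  (∀ {α} → α ∈ supp (coeff g) →
     (1ᴿ -ᴿ ε ≤ᴿ re (coeff g α)) × (re (coeff g α) ≤ᴿ 1ᴿ +ᴿ ε))

IsA : ∀ (n d : ℕ) → Pred ℕ 0ℓ
IsA n d = IsMinimum λ r → ∃ λ (g : Form n d) →
  supp (coeff g) ≐ supp (e n d) × WaringRank g r

IsA⁺ : ∀ (n d : ℕ) → Pred ℕ 0ℓ
IsA⁺ n d = IsMinimum λ r → ∃ λ (g : Form n d) →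
  supp (coeff g) ≐ supp (e n d) × NonNegativeCoefficients g × WaringRank g r

IsAᵋ : ∀ (ε : ℝ) (n d : ℕ) → Pred ℕ 0ℓ
IsAᵋ ε n d = IsMinimum λ r → ∃ λ (g : Form n d) →
  supp (coeff g) ≐ supp (e n d) × CoefficientsNear1 ε g × WaringRank g r

-- A form g with supp g = supp e_{n,d} restricts, on setting the last n − d variables to 0, to a
-- multiple of x₁⋯x_d. If g is a sum of r d-th powers of linear forms with restricted coefficient
-- vectors a₁, …, a_r, comparing coefficients gives ∑ⱼ aⱼ^α = 0 for every exponent α of degree d
-- other than (1,…,1), for which the sum is not 0. Because of this, the 2^(d−1) squarefree monomials
-- in x₂, …, x_d, homogenised to degree d−1 by x₁, are linearly independent as functions on the points
-- a₁, …, a_r, so r ≥ 2^(d−1). This is an elementary form of the argument of Carlini, Catalisano and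
-- Geramita for the rank of a monomial. The other two inequalities are inclusions of the sets
-- over which the minima are taken.

module Submission where

open import Defs
open import Algebra.Bundles using (CommutativeRing; Semiring)
import Algebra.Properties.Monoid.Mult as MonoidMult
open import Algebra.Structures using (IsCommutativeRing)
open import Data.Bool.Base using (if_then_else_)
open import Data.Fin.Base using (Fin; zero; suc; toℕ; punchIn; remQuot; combine)
open import Data.Fin.Properties using (punchInᵢ≢i; 2↔Bool; combine-remQuot)
open import Data.Fin.Subset using (Subset; inside; outside; ∣_∣; ∁)
open import Data.Fin.Subset.Properties using (∣p∣≤n; ∣∁p∣≡n∸∣p∣)
open import Data.List.Base as List using (List; []; _∷_; filter)
open import Data.List.Membership.Propositional using (_∈_; lose)
open import Data.List.Membership.Propositional.Properties
  using (∈-map⁺; ∈-++⁺ˡ; ∈-++⁺ʳ; ∈-filter⁺; ∈-filter⁻)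
open import Data.List.Properties using (filter-some; filter-none)
open import Data.List.Relation.Unary.All as All using (All)
open import Data.List.Relation.Unary.Any using (here)
open import Data.Nat.Base as ℕ using (ℕ; zero; suc; _≤_; _<_; _∸_; _⊔_; z≤n; s≤s)
import Data.Nat.Properties as ℕ
open import Data.Product.Base using (∃; _×_; _,_; proj₁; proj₂; uncurry)
open import Data.Rational.Base as ℚ using (ℚ; 0ℚ; 1ℚ; ½; Positive)
import Data.Rational.Properties as ℚ
open import Data.Rational.Solver using (module +-*-Solver)
open import Data.Sum.Base using (_⊎_; inj₁; inj₂)
open import Data.Vec.Base as Vec using (Vec; []; _∷_; _++_; zipWith; replicate; head; tail; take)
open import Data.Vec.Functional using (removeAt; insertAt)
open import Data.Vec.Functional.Properties using (insertAt-lookup; insertAt-punchIn)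
import Data.Vec.Properties as Vec
open import Function.Base using (_∘_)
open import Function.Bundles using (Inverse; Injection)
open import Function.Properties.Inverse using (↔⇒↣)
open import Level as Level using (0ℓ)
open import Relation.Binary.PropositionalEquality as ≡ using (_≡_; _≢_; cong; cong₂; subst)
open import Relation.Nullary.Decidable using (Dec; yes; no; does; decidable-stable)
open import Relation.Nullary.Negation using (¬_; contradiction)
open import Relation.Unary using (Pred; _≐_)
open +-*-Solver using (_:=_; _:+_; _:*_; :-_; con) renaming (solve to solveℚ)

-- Subsets and squarefree exponent vectors.

sum-indicator : ∀ {n} (S : Subset n) → Vec.sum (indicator S) ≡ ∣ S ∣
sum-indicator []            = ≡.refl
sum-indicator (inside ∷ S)  = cong suc (sum-indicator S)
sum-indicator (outside ∷ S) = sum-indicator S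

-- Among squarefree monomials, only that of `S` completes the monomial of `∁ S` to the full product.
-- This isolates one coefficient of a relation in `leading-coefficient`.
indicator-∁ : ∀ {n} (S T : Subset n) →
  zipWith ℕ._+_ (indicator (∁ S)) (indicator T) ≡ replicate n 1 → T ≡ S
indicator-∁ []            []            _  = ≡.refl
indicator-∁ (inside ∷ S)  (inside ∷ T)  eq = cong (inside ∷_) (indicator-∁ S T (Vec.∷-injectiveʳ eq))
indicator-∁ (inside ∷ S)  (outside ∷ T) ()
indicator-∁ (outside ∷ S) (inside ∷ T)  ()
indicator-∁ (outside ∷ S) (outside ∷ T) eq = cong (outside ∷_) (indicator-∁ S T (Vec.∷-injectiveʳ eq))

indicator-∁-self : ∀ {n} (S : Subset n) →
  zipWith ℕ._+_ (indicator (∁ S)) (indicator S) ≡ replicate n 1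
indicator-∁-self []            = ≡.refl
indicator-∁-self (inside ∷ S)  = cong (1 ∷_) (indicator-∁-self S)
indicator-∁-self (outside ∷ S) = cong (1 ∷_) (indicator-∁-self S)

sum-zipWith-+ : ∀ {n} (α β : Vec ℕ n) → Vec.sum (zipWith ℕ._+_ α β) ≡ Vec.sum α ℕ.+ Vec.sum β
sum-zipWith-+ []      []      = ≡.refl
sum-zipWith-+ (a ∷ α) (b ∷ β) = ≡.trans (cong (a ℕ.+ b ℕ.+_) (sum-zipWith-+ α β))
  (interchange a b (Vec.sum α) (Vec.sum β))
  where open import Algebra.Properties.CommutativeSemigroup ℕ.+-commutativeSemigroup using (interchange)

-- The exponent of a squarefree monomial homogenised to degree `k` by the first variable. The degree
-- is `k` only for `∣ T ∣ ≤ k`, since the subtraction is truncated.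
homogenised : ∀ {m} → ℕ → Subset m → Vec ℕ (suc m)
homogenised k T = (k ∸ ∣ T ∣) ∷ indicator T

-- The degrees are 1 + (m - |S|) and |S|, the latter because `T≤S` makes the truncated subtraction
-- exact. Hence the product is among the monomials of degree m + 1 controlled by `vanishing`.
sum-complement : ∀ {m} (S T : Subset m) → ∣ T ∣ ≤ ∣ S ∣ →
  Vec.sum (zipWith ℕ._+_ (1 ∷ indicator (∁ S)) (homogenised ∣ S ∣ T)) ≡ suc m
sum-complement {m} S T T≤S = begin
  Vec.sum (zipWith ℕ._+_ (1 ∷ indicator (∁ S)) (homogenised ∣ S ∣ T))
    ≡⟨ sum-zipWith-+ (1 ∷ indicator (∁ S)) (homogenised ∣ S ∣ T) ⟩
  suc (Vec.sum (indicator (∁ S))) ℕ.+ (∣ S ∣ ∸ ∣ T ∣ ℕ.+ Vec.sum (indicator T))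
    ≡⟨ cong₂ (λ t u → suc t ℕ.+ (∣ S ∣ ∸ ∣ T ∣ ℕ.+ u)) (sum-indicator (∁ S)) (sum-indicator T) ⟩
  suc ∣ ∁ S ∣ ℕ.+ (∣ S ∣ ∸ ∣ T ∣ ℕ.+ ∣ T ∣)
    ≡⟨ cong₂ (λ t u → suc t ℕ.+ u) (∣∁p∣≡n∸∣p∣ S) (ℕ.m∸n+n≡m T≤S) ⟩
  suc (m ∸ ∣ S ∣ ℕ.+ ∣ S ∣)
    ≡⟨ cong suc (ℕ.m∸n+n≡m (∣p∣≤n S)) ⟩
  suc m ∎
  where open ≡.≡-Reasoning

-- The binary digits of the index, most significant first, are the membership bits.
nthSubset : ∀ m → Fin (2 ℕ.^ m) → Subset m
nthSubset zero    _ = []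
nthSubset (suc m) i =
  Inverse.to 2↔Bool (proj₁ (remQuot {2} (2 ℕ.^ m) i)) ∷ nthSubset m (proj₂ (remQuot {2} (2 ℕ.^ m) i))

nthSubset-injective : ∀ m {i j} → nthSubset m i ≡ nthSubset m j → i ≡ j
nthSubset-injective zero    {zero} {zero} _ = ≡.refl
nthSubset-injective (suc m) {i}    {j}    eq = begin
  i                                              ≡⟨ combine-remQuot {2} (2 ℕ.^ m) i ⟨
  uncurry combine (remQuot {2} (2 ℕ.^ m) i)      ≡⟨ cong₂ combine
    (Injection.injective (↔⇒↣ 2↔Bool) (Vec.∷-injectiveˡ eq)) (nthSubset-injective m (Vec.∷-injectiveʳ eq)) ⟩
  uncurry combine (remQuot {2} (2 ℕ.^ m) j)      ≡⟨ combine-remQuot {2} (2 ℕ.^ m) j ⟩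
  j                                              ∎
  where open ≡.≡-Reasoning

-- Monomials and power sums in a commutative ring.

module Monomials {c ℓ} (R : CommutativeRing c ℓ) where
  open CommutativeRing R hiding (zero)
  open import Algebra.Definitions.RawSemiring (Semiring.rawSemiring semiring) public using (_^_)
  open import Algebra.Properties.Semiring.Sum semiring public using (sum)
  open import Algebra.Properties.Semiring.Exp semiring using (^-homo-*)
  open import Algebra.Properties.CommutativeSemigroup *-commutativeSemigroup using (interchange)

  monomial : ∀ {n} → Vec Carrier n → Vec ℕ n → Carrier
  monomial []      []      = 1#
  monomial (x ∷ a) (k ∷ α) = x ^ k * monomial a α

  monomial-homo : ∀ {n} (a : Vec Carrier n) α β →
    monomial a (zipWith ℕ._+_ α β) ≈ monomial a α * monomial a β
  monomial-homo []      []      []      = sym (*-identityˡ 1#)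
  monomial-homo (x ∷ a) (k ∷ α) (l ∷ β) =
    trans (*-cong (^-homo-* x k l) (monomial-homo a α β)) (interchange _ _ _ _)

  powerSum : ∀ {n r} → (Fin r → Vec Carrier n) → Vec ℕ n → Carrier
  powerSum p α = sum λ j → monomial (p j) α

-- Negated equations replace apartness: on a ring of Cauchy reals, equality to 0
-- is ¬¬-stable but not decidable.
record IsStableDomain {c ℓ} (R : CommutativeRing c ℓ) : Set (c Level.⊔ ℓ) where
  open CommutativeRing R
  open MonoidMult +-monoid using () renaming (_×_ to _·_; ×-homo-1 to ·-homo-1)
  field
    ≈0-stable       : ∀ {x} → ¬ ¬ x ≈ 0# → x ≈ 0#
    *-cancel-≉0     : ∀ {x y} → x * y ≈ 0# → ¬ x ≈ 0# → y ≈ 0#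
    characteristic0 : ∀ n → ¬ suc n · 1# ≈ 0#

  1≉0 : ¬ 1# ≈ 0#
  1≉0 1≈0 = characteristic0 0 (trans (·-homo-1 1#) 1≈0)

-- Linear independence and the lower bound on the number of points.

module PowerSums {c ℓ} (R : CommutativeRing c ℓ) (R-isStableDomain : IsStableDomain R) where
  open CommutativeRing R hiding (zero)
  open IsStableDomain R-isStableDomain
  open Monomials R
  open import Algebra.Properties.Group +-group using (//-rightDividesˡ)
  open import Algebra.Properties.Semiring.Exp semiring using (^-homo-*)
  open import Algebra.Properties.Semiring.Sum semiring using
    (sum-cong-≋; sum-replicate-zero; sum-remove; ∑-comm; *-distribˡ-sum; *-distribʳ-sum; ∑-distrib-+)
  open import Algebra.Properties.CommutativeSemigroup *-commutativeSemigroup using (x∙yz≈y∙xz; xy∙z≈xz∙y)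
  open import Relation.Binary.Reasoning.Setoid setoid

  sum-zero : ∀ {n} (t : Fin n → Carrier) → (∀ i → t i ≈ 0#) → sum t ≈ 0#
  sum-zero {n} t t≈0 = trans (sum-cong-≋ t≈0) (sum-replicate-zero n)

  sum-single : ∀ {n} (t : Fin n → Carrier) i → (∀ j → j ≢ i → t j ≈ 0#) → sum t ≈ t i
  sum-single {suc n} t i t≈0 = begin
    sum t                       ≈⟨ sum-remove t ⟩
    t i + sum (removeAt t i)    ≈⟨ +-congˡ (sum-zero _ λ j → t≈0 _ (punchInᵢ≢i i j)) ⟩
    t i + 0#                    ≈⟨ +-identityʳ (t i) ⟩
    t i                         ∎

  sum-head : ∀ {n} (t : Fin (suc n) → Carrier) x → t zero ≈ x → (∀ i → t (suc i) ≈ 0#) → sum t ≈ x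
  sum-head t x t₀≈x t≈0 = trans (+-cong t₀≈x (sum-zero _ t≈0)) (+-identityʳ x)

  sum-head₂ : ∀ {n} (t : Fin (suc (suc n)) → Carrier) x y →
    t zero ≈ x → t (suc zero) ≈ y → (∀ i → t (suc (suc i)) ≈ 0#) → sum t ≈ y + x
  sum-head₂ t x y t₀≈x t₁≈y t≈0 =
    trans (+-cong t₀≈x (sum-head (λ i → t (suc i)) y t₁≈y t≈0)) (+-comm x y)

  -- By stability assume `x * z` is not 0. Then `x` is not 0 either, so the factors of `x ^ k`
  -- cancel one at a time. The factor `x` kept in the conclusion covers the case where `x` is 0.
  ^-cancel : ∀ x z k → x ^ k * z ≈ 0# → x * z ≈ 0#
  ^-cancel x z zero    eq = trans (*-congˡ (trans (sym (*-identityˡ z)) eq)) (zeroʳ x)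
  ^-cancel x z (suc k) eq = ≈0-stable λ xz≉0 → xz≉0 (^-cancel x z k
    (*-cancel-≉0 (trans (sym (*-assoc x (x ^ k) z)) eq)
      λ x≈0 → xz≉0 (trans (*-congʳ x≈0) (zeroˡ z))))

  LinearlyIndependent : ∀ {N r} → (Fin N → Fin r → Carrier) → Set (c Level.⊔ ℓ)
  LinearlyIndependent {N} v =
    ∀ (a : Fin N → Carrier) → (∀ j → sum (λ i → a i * v i j) ≈ 0#) → ∀ i → a i ≈ 0#

  -- Fraction-free Gaussian elimination of the first coordinate with pivot u = v p zero.
  eliminate : ∀ {N r} (v : Fin (suc N) → Fin (suc r) → Carrier) p → Fin N → Fin r → Carrier
  eliminate v p i j =
    v p zero * v (punchIn p i) (suc j) - v (punchIn p i) zero * v p (suc j)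

  -- A relation `a` among the eliminated vectors lifts to one among the `v i`: the coefficients are
  -- multiplied by `u`, and the pivot row receives `- S`, chosen to kill the first coordinate.
  -- Independence gives `a i * u ≈ 0#`, and `u` cancels.
  eliminate-independent : ∀ {N r} (v : Fin (suc N) → Fin (suc r) → Carrier) p →
    ¬ v p zero ≈ 0# → LinearlyIndependent v → LinearlyIndependent (eliminate v p)
  eliminate-independent {N} v p u≉0 ind a relation i = *-cancel-≉0 u*aᵢ≈0 u≉0
    where
    u  = v p zero
    b  = λ i → a i * u
    w  = λ i → v (punchIn p i)
    S  = sum λ i → a i * w i zero
    bₚ = - S
    b⁺ = insertAt b p bₚ

    expand : ∀ j → sum (λ i → b⁺ i * v i j) ≈ bₚ * v p j + sum (λ i → b i * w i j)
    expand j = begin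
      sum (λ i → b⁺ i * v i j)
        ≈⟨ sum-remove {i = p} (λ i → b⁺ i * v i j) ⟩
      b⁺ p * v p j + sum (λ i → b⁺ (punchIn p i) * w i j)
        ≈⟨ +-cong (*-congʳ (reflexive (insertAt-lookup b p bₚ)))
             (sum-cong-≋ λ i → *-congʳ (reflexive (insertAt-punchIn b p bₚ i))) ⟩
      bₚ * v p j + sum (λ i → b i * w i j) ∎

    S-cancel : ∀ x → bₚ * x + S * x ≈ 0#
    S-cancel x = begin
      - S * x + S * x    ≈⟨ sym (distribʳ x (- S) S) ⟩
      (- S + S) * x      ≈⟨ *-congʳ (-‿inverseˡ S) ⟩
      0# * x             ≈⟨ zeroˡ x ⟩
      0#                 ∎

    vanish : ∀ j → sum (λ i → b⁺ i * v i j) ≈ 0#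
    vanish zero = begin
      sum (λ i → b⁺ i * v i zero)                ≈⟨ expand zero ⟩
      bₚ * u + sum (λ i → b i * w i zero)        ≈⟨ +-congˡ (sum-cong-≋ λ i → xy∙z≈xz∙y (a i) u (w i zero)) ⟩
      bₚ * u + sum (λ i → a i * w i zero * u)    ≈⟨ +-congˡ (sym (*-distribʳ-sum {N} u _)) ⟩
      bₚ * u + S * u                             ≈⟨ S-cancel u ⟩
      0#                                         ∎
    vanish (suc j) = begin
      sum (λ i → b⁺ i * v i (suc j))
        ≈⟨ expand (suc j) ⟩
      bₚ * x + sum (λ i → b i * w i (suc j))
        ≈⟨ +-congˡ (sum-cong-≋ regroup) ⟩
      bₚ * x + sum (λ i → a i * eliminate v p i j + a i * w i zero * x)
        ≈⟨ +-congˡ (∑-distrib-+ (λ i → a i * eliminate v p i j) _) ⟩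
      bₚ * x + (sum (λ i → a i * eliminate v p i j) + sum (λ i → a i * w i zero * x))
        ≈⟨ +-congˡ (+-cong (relation j) (sym (*-distribʳ-sum {N} x _))) ⟩
      bₚ * x + (0# + S * x)
        ≈⟨ +-congˡ (+-identityˡ (S * x)) ⟩
      bₚ * x + S * x
        ≈⟨ S-cancel x ⟩
      0# ∎
      where
      x = v p (suc j)
      regroup : ∀ i → b i * w i (suc j) ≈ a i * eliminate v p i j + a i * w i zero * x
      regroup i = begin
        a i * u * w i (suc j)
          ≈⟨ *-assoc (a i) u (w i (suc j)) ⟩
        a i * (u * w i (suc j))
          ≈⟨ *-congˡ (sym (//-rightDividesˡ (w i zero * x) (u * w i (suc j)))) ⟩
        a i * (eliminate v p i j + w i zero * x)
          ≈⟨ distribˡ (a i) (eliminate v p i j) (w i zero * x) ⟩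
        a i * eliminate v p i j + a i * (w i zero * x)
          ≈⟨ +-congˡ (sym (*-assoc (a i) (w i zero) x)) ⟩
        a i * eliminate v p i j + a i * w i zero * x ∎

    u*aᵢ≈0 : u * a i ≈ 0#
    u*aᵢ≈0 = begin
      u * a i            ≈⟨ *-comm u (a i) ⟩
      a i * u            ≈⟨ reflexive (≡.sym (insertAt-punchIn b p bₚ i)) ⟩
      b⁺ (punchIn p i)   ≈⟨ ind b⁺ vanish (punchIn p i) ⟩
      0#                 ∎


  -- Whether the first coordinate has a pivot cannot be decided, but `_≤_` on numbers can, so the
  -- argument is by contradiction. Any pivot would give the bound by elimination; hence all first
  -- entries are 0, and dropping that coordinate gives the bound as well.
  independent⇒≤ : ∀ {N r} (v : Fin N → Fin r → Carrier) → LinearlyIndependent v → N ≤ r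
  independent⇒≤ {zero}          v ind = z≤n
  independent⇒≤ {suc N} {zero}  v ind = contradiction (ind (λ _ → 1#) (λ ()) zero) 1≉0
  independent⇒≤ {suc N} {suc r} v ind = decidable-stable (suc N ℕ.≤? suc r) λ N≰r →
    let no-pivot : ∀ p → v p zero ≈ 0#
        no-pivot p = ≈0-stable λ u≉0 → N≰r (s≤s
          (independent⇒≤ (eliminate v p) (eliminate-independent v p u≉0 ind)))
    in N≰r (ℕ.m≤n⇒m≤1+n (independent⇒≤ (λ i j → v i (suc j)) λ a relation → ind a λ where
         zero    → sum-zero _ λ i → trans (*-congˡ (no-pivot i)) (zeroʳ (a i))
         (suc j) → relation j))

  -- Let S i be a largest set whose coefficient in a relation is not 0. Cancelling powers of x down to
  -- degree |S i| needs one spare factor x, as x may vanish at a point; multiplying by the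
  -- complement of S i then leaves only the coefficient a i times the power sum at (1,…,1).
  module _ {m r} (x : Fin r → Carrier) (y : Fin r → Vec Carrier m)
    (vanishing : ∀ α → Vec.sum α ≡ suc m → α ≢ replicate (suc m) 1 → powerSum (λ j → x j ∷ y j) α ≈ 0#)
    (nonvanishing : ¬ powerSum (λ j → x j ∷ y j) (replicate (suc m) 1) ≈ 0#) where

    private
      p : Fin r → Vec Carrier (suc m)
      p j = x j ∷ y j

      S : Fin (2 ℕ.^ m) → Subset m
      S = nthSubset m

    squarefree : Fin (2 ℕ.^ m) → Fin r → Carrier
    squarefree i j = monomial (p j) (homogenised m (S i))

    module _ (a : Fin (2 ℕ.^ m) → Carrier) (relation : ∀ j → sum (λ i → a i * squarefree i j) ≈ 0#)
      (i : Fin (2 ℕ.^ m)) (higher : ∀ i′ → ∣ S i ∣ < ∣ S i′ ∣ → a i′ ≈ 0#) where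

      private
        k = ∣ S i ∣

        k≤m : k ≤ m
        k≤m = ∣p∣≤n (S i)

        P : Fin r → Carrier
        P j = sum λ i′ → a i′ * monomial (p j) (homogenised k (S i′))

        γ : Vec ℕ (suc m)
        γ = 1 ∷ indicator (∁ (S i))

        x^*P : ∀ j → x j ^ (m ∸ k) * P j ≈ 0#
        x^*P j = begin
          x j ^ (m ∸ k) * P j                                                              ≈⟨ *-distribˡ-sum {2 ℕ.^ m} _ _ ⟩
          sum (λ i′ → x j ^ (m ∸ k) * (a i′ * monomial (p j) (homogenised k (S i′))))      ≈⟨ sum-cong-≋ term ⟩
          sum (λ i′ → a i′ * squarefree i′ j)                                              ≈⟨ relation j ⟩
          0#                                                                               ∎
          where
          term : ∀ i′ → x j ^ (m ∸ k) * (a i′ * monomial (p j) (homogenised k (S i′))) ≈ a i′ * squarefree i′ j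
          -- For larger sets the truncated `k ∸ ∣ S i′ ∣` gives the wrong degree, but there `higher`
          -- makes both sides 0.
          term i′ with ℕ.≤-<-connex ∣ S i′ ∣ k
          ... | inj₁ s≤k = begin
            x j ^ (m ∸ k) * (a i′ * (x j ^ (k ∸ s) * q))    ≈⟨ x∙yz≈y∙xz _ _ _ ⟩
            a i′ * (x j ^ (m ∸ k) * (x j ^ (k ∸ s) * q))    ≈⟨ *-congˡ (sym (*-assoc _ _ q)) ⟩
            a i′ * (x j ^ (m ∸ k) * x j ^ (k ∸ s) * q)      ≈⟨ *-congˡ (*-congʳ (sym (^-homo-* (x j) (m ∸ k) (k ∸ s)))) ⟩
            a i′ * (x j ^ (m ∸ k ℕ.+ (k ∸ s)) * q)          ≈⟨ *-congˡ (*-congʳ (reflexive (cong (x j ^_) degree))) ⟩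
            a i′ * (x j ^ (m ∸ s) * q)                      ∎
            where
            s = ∣ S i′ ∣
            q = monomial (y j) (indicator (S i′))
            degree : m ∸ k ℕ.+ (k ∸ s) ≡ m ∸ s
            degree = ≡.trans (≡.sym (ℕ.+-∸-assoc (m ∸ k) s≤k)) (cong (_∸ s) (ℕ.m∸n+n≡m k≤m))
          ... | inj₂ k<s = begin
            x j ^ (m ∸ k) * (a i′ * monomial (p j) (homogenised k (S i′)))    ≈⟨ x∙yz≈y∙xz _ _ _ ⟩
            a i′ * (x j ^ (m ∸ k) * monomial (p j) (homogenised k (S i′)))    ≈⟨ *-congʳ (higher i′ k<s) ⟩
            0# * (x j ^ (m ∸ k) * monomial (p j) (homogenised k (S i′)))      ≈⟨ zeroˡ _ ⟩
            0#                                                                ≈⟨ zeroˡ _ ⟨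
            0# * squarefree i′ j                                              ≈⟨ *-congʳ (higher i′ k<s) ⟨
            a i′ * squarefree i′ j                                            ∎

        -- The leading 1 of `γ` supplies the spare factor `x j` that `^-cancel` requires.
        γ*P : ∀ j → monomial (p j) γ * P j ≈ 0#
        γ*P j = begin
          x j * 1# * q * P j      ≈⟨ *-congʳ (*-congʳ (*-identityʳ (x j))) ⟩
          x j * q * P j           ≈⟨ xy∙z≈xz∙y (x j) q (P j) ⟩
          x j * P j * q           ≈⟨ *-congʳ (^-cancel (x j) (P j) (m ∸ k) (x^*P j)) ⟩
          0# * q                  ≈⟨ zeroˡ q ⟩
          0#                      ∎
          where q = monomial (y j) (indicator (∁ (S i)))

        exponent : Fin (2 ℕ.^ m) → Vec ℕ (suc m)
        exponent i′ = zipWith ℕ._+_ γ (homogenised k (S i′))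

        -- Exchanging the sums over sets and points turns the pointwise identity `γ*P` into a
        -- relation between power sums.
        expand : sum (λ i′ → a i′ * powerSum p (exponent i′)) ≈ 0#
        expand = begin
          sum (λ i′ → a i′ * powerSum p (exponent i′))
            ≈⟨ sum-cong-≋ (λ i′ → *-distribˡ-sum {r} (a i′) _) ⟩
          sum (λ i′ → sum λ j → a i′ * monomial (p j) (exponent i′))
            ≈⟨ ∑-comm (λ i′ j → a i′ * monomial (p j) (exponent i′)) ⟩
          sum (λ j → sum λ i′ → a i′ * monomial (p j) (exponent i′))
            ≈⟨ sum-cong-≋ (λ j → sum-cong-≋ λ i′ → trans
                 (*-congˡ (monomial-homo (p j) γ (homogenised k (S i′)))) (x∙yz≈y∙xz _ _ _)) ⟩
          sum (λ j → sum λ i′ → monomial (p j) γ * (a i′ * monomial (p j) (homogenised k (S i′))))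
            ≈⟨ sum-cong-≋ (λ j → sym (*-distribˡ-sum {2 ℕ.^ m} (monomial (p j) γ) _)) ⟩
          sum (λ j → monomial (p j) γ * P j)
            ≈⟨ sum-zero _ γ*P ⟩
          0# ∎

        exponent-self : exponent i ≡ replicate (suc m) 1
        exponent-self = cong₂ _∷_ (cong suc (ℕ.n∸n≡0 k)) (indicator-∁-self (S i))

        -- Sets no larger than `S i` give an exponent of degree m + 1 other than (1,...,1); larger
        -- sets have coefficient 0.
        others-vanish : ∀ i′ → i′ ≢ i → a i′ * powerSum p (exponent i′) ≈ 0#
        others-vanish i′ i′≢i with ℕ.≤-<-connex ∣ S i′ ∣ k
        ... | inj₁ s≤k = trans (*-congˡ (vanishing (exponent i′) (sum-complement (S i) (S i′) s≤k) λ eq →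
                i′≢i (nthSubset-injective m (indicator-∁ (S i) (S i′) (Vec.∷-injectiveʳ eq))))) (zeroʳ _)
        ... | inj₂ k<s = trans (*-congʳ (higher i′ k<s)) (zeroˡ _)

      leading-coefficient : a i ≈ 0#
      leading-coefficient = *-cancel-≉0
        (begin
          powerSum p (replicate (suc m) 1) * a i           ≈⟨ *-comm _ (a i) ⟩
          a i * powerSum p (replicate (suc m) 1)           ≈⟨ *-congˡ (reflexive (cong (powerSum p) (≡.sym exponent-self))) ⟩
          a i * powerSum p (exponent i)                    ≈⟨ sum-single _ i others-vanish ⟨
          sum (λ i′ → a i′ * powerSum p (exponent i′))     ≈⟨ expand ⟩
          0#                                               ∎)
        nonvanishing

    squarefree-independent : LinearlyIndependent squarefree
    -- Descending induction on the size of `S i`: `b` bounds the codimension `m ∸ ∣ S i ∣`, which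
    -- drops strictly as the set grows.
    squarefree-independent a relation i = go (suc m) i (s≤s (ℕ.m∸n≤m m ∣ S i ∣))
      where
      go : ∀ b i → m ∸ ∣ S i ∣ < b → a i ≈ 0#
      go (suc b) i (s≤s i<b) = leading-coefficient a relation i λ i′ i<i′ →
        go b i′ (ℕ.<-≤-trans (ℕ.∸-monoʳ-< i<i′ (∣p∣≤n (S i′))) i<b)

    2^m≤length : 2 ℕ.^ m ≤ r
    2^m≤length = independent⇒≤ squarefree squarefree-independent

-- Multinomial coefficients and powers of linear forms.

-- The sum of F(α - eᵢ) over the positions i with αᵢ > 0, as in Pascal's recursion.
predecessorSum : ∀ {n} → (Vec ℕ n → ℕ) → Vec ℕ n → ℕ
predecessorSum F []          = 0
predecessorSum F (zero ∷ α)  = predecessorSum (F ∘ (0 ∷_)) α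
predecessorSum F (suc k ∷ α) = F (k ∷ α) ℕ.+ predecessorSum (F ∘ (suc k ∷_)) α

-- Counts lattice paths of `d` unit steps from 0 to `α`: this is d!/α! when |α| = d, and 0
-- otherwise. The recursion mirrors multiplication by a linear form.
multinomial : ∀ {n} → ℕ → Vec ℕ n → ℕ
multinomial {n} zero    α = if does (Vec.≡-dec ℕ._≟_ (replicate n 0) α) then 1 else 0
multinomial     (suc d) α = predecessorSum (multinomial d) α

predecessorSum>0 : ∀ {n} d (F : Vec ℕ n → ℕ) → (∀ α → Vec.sum α ≡ d → 0 < F α) →
  ∀ α → Vec.sum α ≡ suc d → 0 < predecessorSum F α
predecessorSum>0 d F F>0 (zero ∷ α)  eq = predecessorSum>0 d (F ∘ (0 ∷_)) (λ β → F>0 (0 ∷ β)) α eq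
predecessorSum>0 d F F>0 (suc k ∷ α) eq = ℕ.<-≤-trans (F>0 (k ∷ α) (ℕ.suc-injective eq)) (ℕ.m≤m+n _ _)

sum≡0⇒≡replicate : ∀ {n} (α : Vec ℕ n) → Vec.sum α ≡ 0 → replicate n 0 ≡ α
sum≡0⇒≡replicate []         _  = ≡.refl
sum≡0⇒≡replicate (zero ∷ α) eq = cong (0 ∷_) (sum≡0⇒≡replicate α eq)

multinomial>0 : ∀ {n} d (α : Vec ℕ n) → Vec.sum α ≡ d → 0 < multinomial d α
multinomial>0 {n} zero α eq with Vec.≡-dec ℕ._≟_ (replicate n 0) α
... | yes _ = s≤s z≤n
... | no ≢α = contradiction (sum≡0⇒≡replicate α eq) ≢α
multinomial>0 (suc d) α eq = predecessorSum>0 d (multinomial d) (multinomial>0 d) α eq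

sum-++-replicate-0 : ∀ {n} (α : Vec ℕ n) k → Vec.sum (α ++ replicate k 0) ≡ Vec.sum α
sum-++-replicate-0 []      zero    = ≡.refl
sum-++-replicate-0 []      (suc k) = sum-++-replicate-0 [] k
sum-++-replicate-0 (a ∷ α) k       = cong (a ℕ.+_) (sum-++-replicate-0 α k)

module LinearForms {c ℓ} (R : CommutativeRing c ℓ) where
  open CommutativeRing R hiding (zero)
  open Monomials R
  open import Algebra.Properties.Monoid.Mult +-monoid using () renaming (_×_ to _·_; ×-homo-+ to ·-homo-+)
  open import Algebra.Properties.CommutativeSemigroup *-commutativeSemigroup using (x∙yz≈y∙xz)
  open import Relation.Binary.Reasoning.Setoid setoid

  -- The coefficient of x^α in (∑ aᵢxᵢ) · ∑ f(β) x^β.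
  linear* : ∀ {n} → Vec Carrier n → (Vec ℕ n → Carrier) → Vec ℕ n → Carrier
  linear* []      f []          = 0#
  linear* (x ∷ a) f (zero ∷ α)  = linear* a (f ∘ (0 ∷_)) α
  linear* (x ∷ a) f (suc k ∷ α) = x * f (k ∷ α) + linear* a (f ∘ (suc k ∷_)) α

  ι : ℕ → Carrier
  ι n = n · 1#

  private
    regroup : ∀ t q i w → t * (i * (q * w)) ≈ t * q * (i * w)
    regroup t q i w = trans (*-congˡ (x∙yz≈y∙xz i q w)) (sym (*-assoc t q (i * w)))

  -- The factor `t` collects the powers of the coordinates already passed, which makes the induction
  -- along the exponent vector close.
  linear*-monomial : ∀ {n} (a : Vec Carrier n) t F f → (∀ α → f α ≈ t * (ι (F α) * monomial a α)) →
    ∀ α → linear* a f α ≈ t * (ι (predecessorSum F α) * monomial a α)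
  linear*-monomial []      t F f f≈ []          = sym (trans (*-congˡ (zeroˡ 1#)) (zeroʳ t))
  linear*-monomial (x ∷ a) t F f f≈ (zero ∷ α)  = trans
    (linear*-monomial a (t * 1#) (F ∘ (0 ∷_)) (f ∘ (0 ∷_)) (λ β → trans (f≈ (0 ∷ β)) (regroup t 1# _ _)) α)
    (sym (regroup t 1# _ _))
  linear*-monomial (x ∷ a) t F f f≈ (suc k ∷ α) = begin
    x * f (k ∷ α) + linear* a (f ∘ (suc k ∷_)) α
      ≈⟨ +-cong (*-congˡ (f≈ (k ∷ α))) (linear*-monomial a (t * x ^ suc k) (F ∘ (suc k ∷_)) (f ∘ (suc k ∷_))
           (λ β → trans (f≈ (suc k ∷ β)) (regroup t (x ^ suc k) _ _)) α) ⟩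
    x * (t * (ι p * (x ^ k * w))) + t * x ^ suc k * (ι q * w)
      ≈⟨ +-cong pull (sym (regroup t (x ^ suc k) (ι q) w)) ⟩
    t * (ι p * (x ^ suc k * w)) + t * (ι q * (x ^ suc k * w))
      ≈⟨ distribˡ t _ _ ⟨
    t * (ι p * (x ^ suc k * w) + ι q * (x ^ suc k * w))
      ≈⟨ *-congˡ (trans (sym (distribʳ _ (ι p) (ι q))) (*-congʳ (sym (·-homo-+ 1# p q)))) ⟩
    t * (ι (p ℕ.+ q) * (x ^ suc k * w)) ∎
    where
    p = F (k ∷ α)
    q = predecessorSum (F ∘ (suc k ∷_)) α
    w = monomial a α
    pull : x * (t * (ι p * (x ^ k * w))) ≈ t * (ι p * (x ^ suc k * w))
    pull = begin
      x * (t * (ι p * (x ^ k * w)))    ≈⟨ x∙yz≈y∙xz x t _ ⟩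
      t * (x * (ι p * (x ^ k * w)))    ≈⟨ *-congˡ (x∙yz≈y∙xz x (ι p) _) ⟩
      t * (ι p * (x * (x ^ k * w)))    ≈⟨ *-congˡ (*-congˡ (sym (*-assoc x (x ^ k) w))) ⟩
      t * (ι p * (x ^ suc k * w))      ∎

  monomial-0 : ∀ {n} (a : Vec Carrier n) → monomial a (replicate n 0) ≈ 1#
  monomial-0 []      = refl
  monomial-0 (x ∷ a) = trans (*-identityˡ _) (monomial-0 a)

  -- The multinomial theorem for a linear form. Stating it for any `f` with the recursion of powers
  -- lets it apply to `_^ˢ_` on power series.
  linearPower : ∀ {n} (a : Vec Carrier n) (f : ℕ → Vec ℕ n → Carrier) →
    (∀ α → f 0 α ≡ (if does (Vec.≡-dec ℕ._≟_ (replicate n 0) α) then 1# else 0#)) →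
    (∀ d α → f (suc d) α ≈ linear* a (f d) α) →
    ∀ d α → f d α ≈ ι (multinomial d α) * monomial a α
  linearPower {n} a f f0 f+ zero    α rewrite f0 α with Vec.≡-dec ℕ._≟_ (replicate n 0) α
  ... | yes ≡.refl = sym (trans (*-cong (+-identityʳ 1#) (monomial-0 a)) (*-identityˡ 1#))
  ... | no _       = sym (zeroˡ (monomial a α))
  linearPower     a f f0 f+ (suc d) α = begin
    f (suc d) α
      ≈⟨ f+ d α ⟩
    linear* a (f d) α
      ≈⟨ linear*-monomial a 1# (multinomial d) (f d)
           (λ β → trans (linearPower a f f0 f+ d β) (sym (*-identityˡ _))) α ⟩
    1# * (ι (multinomial (suc d) α) * monomial a α)
      ≈⟨ *-identityˡ _ ⟩
    ι (multinomial (suc d) α) * monomial a α ∎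

  monomial-++-0 : ∀ {m k} (a : Vec Carrier (m ℕ.+ k)) (α : Vec ℕ m) →
    monomial a (α ++ replicate k 0) ≈ monomial (take m a) α
  monomial-++-0 a       []      = monomial-0 a
  monomial-++-0 (x ∷ a) (t ∷ α) = *-congˡ (monomial-++-0 a α)

-- The rank bound over a stable domain.

module WaringBound {c ℓ} (R : CommutativeRing c ℓ) (R-isStableDomain : IsStableDomain R) where
  open CommutativeRing R hiding (zero)
  open IsStableDomain R-isStableDomain
  open Monomials R
  open LinearForms R
  open PowerSums R R-isStableDomain
  open import Algebra.Properties.Semiring.Sum semiring using (sum-cong-≋; *-distribˡ-sum)

  ι>0⇒≉0 : ∀ {n} → 0 < n → ¬ ι n ≈ 0#
  ι>0⇒≉0 {suc n} _ = characteristic0 n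

  -- Setting the last `k` variables to 0 truncates the points. Each remaining coefficient is a
  -- positive multinomial times a power sum, so characteristic 0 carries the conditions on `g` over
  -- to power sums.
  waring-bound : ∀ {m k r} (a : Fin r → Vec Carrier (suc m ℕ.+ k)) (g : Vec ℕ (suc m ℕ.+ k) → Carrier) →
    (∀ α → g α ≈ sum λ j → ι (multinomial (suc m) α) * monomial (a j) α) →
    (∀ β → Vec.sum β ≡ suc m → β ≢ replicate (suc m) 1 → g (β ++ replicate k 0) ≈ 0#) →
    ¬ g (replicate (suc m) 1 ++ replicate k 0) ≈ 0# →
    2 ℕ.^ m ≤ r
  waring-bound {m} {k} {r} a g g≈ vanishing nonvanishing = 2^m≤length (head ∘ a) (λ j → take m (tail (a j)))
    (λ β β-sum β≢1 → *-cancel-≉0 (trans (sym (g≈powerSum β)) (vanishing β β-sum β≢1))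
      (ι>0⇒≉0 (multinomial>0 (suc m) (β ++ replicate k 0) (≡.trans (sum-++-replicate-0 β k) β-sum))))
    (λ powerSum≈0 → nonvanishing (trans (g≈powerSum (replicate (suc m) 1)) (trans (*-congˡ powerSum≈0) (zeroʳ _))))
    where
    restrict : ∀ (a : Vec Carrier (suc m ℕ.+ k)) β →
      monomial a (β ++ replicate k 0) ≈ monomial (head a ∷ take m (tail a)) β
    restrict (x ∷ a) (t ∷ β) = *-congˡ (monomial-++-0 a β)

    g≈powerSum : ∀ β → g (β ++ replicate k 0) ≈
      ι (multinomial (suc m) (β ++ replicate k 0)) * powerSum (λ j → head (a j) ∷ take m (tail (a j))) β
    g≈powerSum β = trans (g≈ _) (trans
      (sum-cong-≋ {r} λ j → *-congˡ (restrict (a j) β))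
      (sym (*-distribˡ-sum {r} _ _)))

-- Cauchy reals and complex numbers

eventually₂ : ∀ {P Q R : Pred ℕ 0ℓ} → (∀ n → P n → Q n → R n) →
  Eventually P → Eventually Q → Eventually R
eventually₂ f (M , p) (N , q) = M ⊔ N , λ n M⊔N≤n →
  f n (p n (ℕ.m⊔n≤o⇒m≤o M N M⊔N≤n)) (q n (ℕ.m⊔n≤o⇒n≤o M N M⊔N≤n))

eventually : ∀ {P Q : Pred ℕ 0ℓ} → (∀ n → P n → Q n) → Eventually P → Eventually Q
eventually f (N , p) = N , λ n N≤n → f n (p n N≤n)

eventually-contradiction : ∀ {P : Pred ℕ 0ℓ} → Eventually P → Eventually (¬_ ∘ P) → ∀ {A : Set} → A
eventually-contradiction p q with N , absurd ← eventually₂ (λ _ Pn ¬Pn → ¬Pn Pn) p q =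
  contradiction ℕ.≤-refl (absurd N)

½*-positive : ∀ {ε} → 0ℚ ℚ.< ε → 0ℚ ℚ.< ½ ℚ.* ε
½*-positive = ℚ.*-monoʳ-<-pos ½

½+½ : ∀ ε → ½ ℚ.* ε ℚ.+ ½ ℚ.* ε ≡ ε
½+½ ε = ≡.trans (≡.sym (ℚ.*-distribʳ-+ ε ½ ½)) (ℚ.*-identityˡ ε)

∣+∣<ε : ∀ p q ε → ℚ.∣ p ∣ ℚ.< ½ ℚ.* ε → ℚ.∣ q ∣ ℚ.< ½ ℚ.* ε → ℚ.∣ p ℚ.+ q ∣ ℚ.< ε
∣+∣<ε p q ε p< q< = subst (ℚ.∣ p ℚ.+ q ∣ ℚ.<_) (½+½ ε)
  (ℚ.≤-<-trans (ℚ.∣p+q∣≤∣p∣+∣q∣ p q) (ℚ.+-mono-< p< q<))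

∣-∣-sym : ∀ p q → ℚ.∣ p ℚ.- q ∣ ≡ ℚ.∣ q ℚ.- p ∣
∣-∣-sym p q = ≡.trans (≡.sym (ℚ.∣-p∣≡∣p∣ (p ℚ.- q)))
  (cong ℚ.∣_∣ (solveℚ 2 (λ p q → :- (p :+ :- q) := q :+ :- p) ≡.refl p q))

≈ᴿ-pointwise : ∀ {x y} → (∀ n → seq x n ≡ seq y n) → x ≈ᴿ y
≈ᴿ-pointwise {x} {y} x≡y ε ε>0 = 0 , λ n _ → subst (λ q → ℚ.∣ q ∣ ℚ.< ε)
  (≡.sym (≡.trans (cong (ℚ._- seq y n) (x≡y n)) (ℚ.+-inverseʳ (seq y n)))) ε>0

≈ᴿ-sym : ∀ {x y} → x ≈ᴿ y → y ≈ᴿ x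
≈ᴿ-sym {x} {y} x≈y ε ε>0 =
  eventually (λ n → subst (ℚ._< ε) (∣-∣-sym (seq x n) (seq y n))) (x≈y ε ε>0)

≈ᴿ-trans : ∀ {x y z} → x ≈ᴿ y → y ≈ᴿ z → x ≈ᴿ z
≈ᴿ-trans {x} {y} {z} x≈y y≈z ε ε>0 = eventually₂
  (λ n x-y y-z → subst (λ q → ℚ.∣ q ∣ ℚ.< ε) (telescope (seq x n) (seq y n) (seq z n))
    (∣+∣<ε _ _ ε x-y y-z))
  (x≈y _ (½*-positive ε>0)) (y≈z _ (½*-positive ε>0))

+ᴿ-cong : ∀ {x x′ y y′} → x ≈ᴿ x′ → y ≈ᴿ y′ → x +ᴿ y ≈ᴿ x′ +ᴿ y′
+ᴿ-cong {x} {x′} {y} {y′} x≈x′ y≈y′ ε ε>0 = eventually₂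
  (λ n x-x′ y-y′ → subst (λ q → ℚ.∣ q ∣ ℚ.< ε)
    (solveℚ 4 (λ x x′ y y′ → (x :+ :- x′) :+ (y :+ :- y′) := (x :+ y) :+ :- (x′ :+ y′))
      ≡.refl (seq x n) (seq x′ n) (seq y n) (seq y′ n))
    (∣+∣<ε _ _ ε x-x′ y-y′))
  (x≈x′ _ (½*-positive ε>0)) (y≈y′ _ (½*-positive ε>0))

-ᴿ-cong : ∀ {x y} → x ≈ᴿ y → -ᴿ x ≈ᴿ -ᴿ y
-ᴿ-cong {x} {y} x≈y ε ε>0 = eventually
  (λ n → subst (ℚ._< ε) (≡.trans (∣-∣-sym (seq x n) (seq y n))
    (cong ℚ.∣_∣ (solveℚ 2 (λ x y → y :+ :- x := :- x :+ :- (:- y)) ≡.refl (seq x n) (seq y n)))))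
  (x≈y ε ε>0)

*ᴿ-cong : ∀ {x x′ y y′} → x ≈ᴿ x′ → y ≈ᴿ y′ → x *ᴿ y ≈ᴿ x′ *ᴿ y′
*ᴿ-cong {x} {x′} {y} {y′} x≈x′ y≈y′ ε ε>0 =
  let B , B>0 , x-bounded  = cauchy⇒bounded (seq x) (cauchy x)
      C , C>0 , y′-bounded = cauchy⇒bounded (seq y′) (cauchy y′)
      δ , δ>0 , [B+C]δ≡ε   = divide (B ℚ.+ C) (ℚ.pos+pos⇒pos B {{B>0}} C {{C>0}}) ε ε>0
  in eventually₂
    (λ n (x≤B , y′≤C) (x-x′ , y-y′) → subst (ℚ.∣ seq x n ℚ.* seq y n ℚ.- seq x′ n ℚ.* seq y′ n ∣ ℚ.<_) [B+C]δ≡ε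
      (product-close B>0 C>0 (seq x n) (seq y n) (seq x′ n) (seq y′ n) x≤B y′≤C x-x′ y-y′))
    (eventually₂ (λ _ → _,_) x-bounded y′-bounded)
    (eventually₂ (λ _ → _,_) (x≈x′ δ δ>0) (y≈y′ δ δ>0))

-- Null sequences and sequences bounded away from 0.

Null : Pred (ℕ → ℚ) 0ℓ
Null x = ∀ ε → 0ℚ ℚ.< ε → Eventually λ n → ℚ.∣ x n ∣ ℚ.< ε

≈0⇒null : ∀ x → x ≈ᴿ 0ᴿ → Null (seq x)
≈0⇒null x x≈0 ε ε>0 =
  eventually (λ n → subst (λ q → ℚ.∣ q ∣ ℚ.< ε) (ℚ.+-identityʳ (seq x n))) (x≈0 ε ε>0)

null⇒≈0 : ∀ x → Null (seq x) → x ≈ᴿ 0ᴿ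
null⇒≈0 x x→0 ε ε>0 =
  eventually (λ n → subst (λ q → ℚ.∣ q ∣ ℚ.< ε) (≡.sym (ℚ.+-identityʳ (seq x n)))) (x→0 ε ε>0)

BoundedAway : Pred (ℕ → ℚ) 0ℓ
BoundedAway x = ∃ λ δ → 0ℚ ℚ.< δ × Eventually λ n → δ ℚ.≤ ℚ.∣ x n ∣

boundedAway⇒¬null : ∀ {x} → BoundedAway x → ¬ Null x
boundedAway⇒¬null (δ , δ>0 , x≥δ) x→0 =
  eventually-contradiction (x→0 δ δ>0) (eventually (λ _ δ≤x x<δ → ℚ.<-irrefl ≡.refl (ℚ.<-≤-trans x<δ δ≤x)) x≥δ)

-- Past an index N where terms differ by less than ε/4, one decidable comparison of |x N| with ε/2
-- settles the alternative: later terms stay below ε, or stay at least ε/4. This replaces deciding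
-- whether a real is 0.
small-or-boundedAway : ∀ x → Cauchy x → ∀ ε → 0ℚ ℚ.< ε →
  Eventually (λ n → ℚ.∣ x n ∣ ℚ.< ε) ⊎ BoundedAway x
small-or-boundedAway x x-cauchy ε ε>0
  with N , close ← x-cauchy (½ ℚ.* (½ ℚ.* ε)) (½*-positive (½*-positive ε>0))
  with ℚ.∣ x N ∣ ℚ.<? ½ ℚ.* ε
... | yes small = inj₁ (N , λ n N≤n → subst (λ q → ℚ.∣ q ∣ ℚ.< ε) (≡.sym (add-sub (x n) (x N)))
        (∣+∣<ε _ _ ε (ℚ.<-trans (close n N N≤n ℕ.≤-refl) δ<½ε) small))
  where
  δ<½ε : ½ ℚ.* (½ ℚ.* ε) ℚ.< ½ ℚ.* ε
  δ<½ε = ≡.subst₂ ℚ._<_ (ℚ.+-identityʳ _) (½+½ (½ ℚ.* ε))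
    (ℚ.+-monoʳ-< (½ ℚ.* (½ ℚ.* ε)) (½*-positive (½*-positive ε>0)))
... | no large = inj₂ (½ ℚ.* (½ ℚ.* ε) , ½*-positive (½*-positive ε>0) , N , λ n N≤n →
        ℚ.≮⇒≥ λ xₙ<δ → large (subst (λ q → ℚ.∣ q ∣ ℚ.< ½ ℚ.* ε) (≡.sym (add-sub (x N) (x n)))
          (∣+∣<ε _ _ (½ ℚ.* ε) (close N n ℕ.≤-refl N≤n) xₙ<δ)))

null-stable : ∀ x → Cauchy x → ¬ ¬ Null x → Null x
null-stable x x-cauchy ¬¬x→0 ε ε>0 with small-or-boundedAway x x-cauchy ε ε>0
... | inj₁ small = small
... | inj₂ away  = contradiction (boundedAway⇒¬null away) ¬¬x→0

-- If |y| were eventually at least δ, then |x| ≤ |xy|/δ would make `x` null; so `y` is small at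
-- every tolerance.
null-cancel : ∀ (x y : ℕ → ℚ) → Cauchy y → Null (λ n → x n ℚ.* y n) → ¬ Null x → Null y
null-cancel x y y-cauchy xy→0 ¬x→0 ε ε>0 with small-or-boundedAway y y-cauchy ε ε>0
... | inj₁ small = small
... | inj₂ (δ , δ>0 , y≥δ) = contradiction x→0 ¬x→0
  where
  x→0 : Null x
  x→0 η η>0 = eventually₂
    (λ n δ≤y xy<ηδ → ℚ.*-cancelʳ-<-nonNeg δ {{ℚ.pos⇒nonNeg δ {{ℚ.positive δ>0}}}}
      (ℚ.≤-<-trans (ℚ.*-monoˡ-≤-nonNeg ℚ.∣ x n ∣ {{ℚ.∣-∣-nonNeg (x n)}} δ≤y)
        (subst (ℚ._< η ℚ.* δ) (ℚ.∣p*q∣≡∣p∣*∣q∣ (x n) (y n)) xy<ηδ)))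
    y≥δ (xy→0 (η ℚ.* δ) (ℚ.positive⁻¹ _ {{ℚ.pos*pos⇒pos η {{ℚ.positive η>0}} δ {{ℚ.positive δ>0}}}}))

p*p≡∣p∣*∣p∣ : ∀ p → p ℚ.* p ≡ ℚ.∣ p ∣ ℚ.* ℚ.∣ p ∣
p*p≡∣p∣*∣p∣ p with ℚ.∣p∣≡p∨∣p∣≡-p p
... | inj₁ eq = ≡.sym (cong₂ ℚ._*_ eq eq)
... | inj₂ eq = ≡.trans (solveℚ 1 (λ p → p :* p := :- p :* :- p) ≡.refl p) (≡.sym (cong₂ ℚ._*_ eq eq))

0≤p*p : ∀ p → 0ℚ ℚ.≤ p ℚ.* p
0≤p*p p = subst (0ℚ ℚ.≤_) (≡.sym (p*p≡∣p∣*∣p∣ p)) (ℚ.nonNegative⁻¹ _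
  {{ℚ.nonNeg*nonNeg⇒nonNeg ℚ.∣ p ∣ {{ℚ.∣-∣-nonNeg p}} ℚ.∣ p ∣ {{ℚ.∣-∣-nonNeg p}}}})

-- The hypothesis is used at tolerance ε², since |x n| ≥ ε would force the sum of squares to be at
-- least ε².
null-sum-of-squares : ∀ (x y : ℕ → ℚ) → Null (λ n → x n ℚ.* x n ℚ.+ y n ℚ.* y n) → Null x
null-sum-of-squares x y x²+y²→0 ε ε>0 =
  eventually
    (λ n (<ε² : ℚ.∣ x n ℚ.* x n ℚ.+ y n ℚ.* y n ∣ ℚ.< ε ℚ.* ε) → ℚ.≰⇒> λ ε≤x →
      ℚ.<-irrefl ≡.refl (ℚ.<-≤-trans <ε² (ε²≤ n ε≤x)))
    (x²+y²→0 (ε ℚ.* ε) (ℚ.positive⁻¹ _ {{ℚ.pos*pos⇒pos ε ε}}))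
  where
  instance
    ε-positive : Positive ε
    ε-positive = ℚ.positive ε>0

  ε²≤ : ∀ n → ε ℚ.≤ ℚ.∣ x n ∣ → ε ℚ.* ε ℚ.≤ ℚ.∣ x n ℚ.* x n ℚ.+ y n ℚ.* y n ∣
  ε²≤ n ε≤x = begin
    ε ℚ.* ε                                  ≤⟨ ℚ.*-monoʳ-≤-nonNeg ε {{ℚ.pos⇒nonNeg ε}} ε≤x ⟩
    ℚ.∣ x n ∣ ℚ.* ε                          ≤⟨ ℚ.*-monoˡ-≤-nonNeg ℚ.∣ x n ∣ {{ℚ.∣-∣-nonNeg (x n)}} ε≤x ⟩
    ℚ.∣ x n ∣ ℚ.* ℚ.∣ x n ∣                  ≡⟨ p*p≡∣p∣*∣p∣ (x n) ⟨
    x n ℚ.* x n                              ≡⟨ ℚ.+-identityʳ (x n ℚ.* x n) ⟨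
    x n ℚ.* x n ℚ.+ 0ℚ                       ≤⟨ ℚ.+-monoʳ-≤ (x n ℚ.* x n) (0≤p*p (y n)) ⟩
    x n ℚ.* x n ℚ.+ y n ℚ.* y n              ≡⟨ ℚ.0≤p⇒∣p∣≡p (ℚ.+-mono-≤ {0ℚ} {x n ℚ.* x n} {0ℚ} {y n ℚ.* y n} (0≤p*p (x n)) (0≤p*p (y n))) ⟨
    ℚ.∣ x n ℚ.* x n ℚ.+ y n ℚ.* y n ∣        ∎
    where open ℚ.≤-Reasoning

-- The complex numbers as a stable domain.

≈ᶜ-pointwise : ∀ {z w} → (∀ n → seq (re z) n ≡ seq (re w) n) → (∀ n → seq (im z) n ≡ seq (im w) n) → z ≈ᶜ w
≈ᶜ-pointwise {z} {w} re≡ im≡ = ≈ᴿ-pointwise {re z} {re w} re≡ , ≈ᴿ-pointwise {im z} {im w} im≡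

*ᶜ-cong : ∀ {z z′ w w′} → z ≈ᶜ z′ → w ≈ᶜ w′ → z *ᶜ w ≈ᶜ z′ *ᶜ w′
*ᶜ-cong {z} {z′} {w} {w′} (a≈ , b≈) (c≈ , d≈) =
  +ᴿ-cong {a *ᴿ c} {a′ *ᴿ c′} { -ᴿ (b *ᴿ d)} { -ᴿ (b′ *ᴿ d′)} (*ᴿ-cong {a} {a′} {c} {c′} a≈ c≈)
    (-ᴿ-cong {b *ᴿ d} {b′ *ᴿ d′} (*ᴿ-cong {b} {b′} {d} {d′} b≈ d≈)) ,
  +ᴿ-cong {a *ᴿ d} {a′ *ᴿ d′} {b *ᴿ c} {b′ *ᴿ c′} (*ᴿ-cong {a} {a′} {d} {d′} a≈ d≈)
    (*ᴿ-cong {b} {b′} {c} {c′} b≈ c≈)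
  where
  a = re z; a′ = re z′; b = im z; b′ = im z′
  c = re w; c′ = re w′; d = im w; d′ = im w′

abstract
  -- The algebraic laws hold term by term as identities in ℚ; estimates enter only through symmetry,
  -- transitivity and the congruences.
  ℂ-isCommutativeRing : IsCommutativeRing _≈ᶜ_ _+ᶜ_ _*ᶜ_ -ᶜ_ 0ᶜ 1ᶜ
  ℂ-isCommutativeRing = record
    { isRing = record
      { +-isAbelianGroup = record
        { isGroup = record
          { isMonoid = record
            { isSemigroup = record
              { isMagma = record
                { isEquivalence = record
                  { refl  = λ {z} → ≈ᶜ-pointwise {z} {z} (λ _ → ≡.refl) (λ _ → ≡.refl)
                  ; sym   = λ {z} {w} (r , i) → ≈ᴿ-sym {re z} {re w} r , ≈ᴿ-sym {im z} {im w} i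
                  ; trans = λ {z} {w} {v} (r , i) (r′ , i′) →
                      ≈ᴿ-trans {re z} {re w} {re v} r r′ , ≈ᴿ-trans {im z} {im w} {im v} i i′
                  }
                ; ∙-cong = λ {z} {z′} {w} {w′} (r , i) (r′ , i′) →
                    +ᴿ-cong {re z} {re z′} {re w} {re w′} r r′ , +ᴿ-cong {im z} {im z′} {im w} {im w′} i i′
                }
              ; assoc = λ z w v → ≈ᶜ-pointwise {(z +ᶜ w) +ᶜ v} {z +ᶜ (w +ᶜ v)}
                  (λ n → ℚ.+-assoc (seq (re z) n) (seq (re w) n) (seq (re v) n))
                  (λ n → ℚ.+-assoc (seq (im z) n) (seq (im w) n) (seq (im v) n))
              }
            ; identity =
                (λ z → ≈ᶜ-pointwise {0ᶜ +ᶜ z} {z} (λ n → ℚ.+-identityˡ (seq (re z) n)) (λ n → ℚ.+-identityˡ (seq (im z) n))) ,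
                (λ z → ≈ᶜ-pointwise {z +ᶜ 0ᶜ} {z} (λ n → ℚ.+-identityʳ (seq (re z) n)) (λ n → ℚ.+-identityʳ (seq (im z) n)))
            }
          ; inverse =
              (λ z → ≈ᶜ-pointwise { -ᶜ z +ᶜ z} {0ᶜ} (λ n → ℚ.+-inverseˡ (seq (re z) n)) (λ n → ℚ.+-inverseˡ (seq (im z) n))) ,
              (λ z → ≈ᶜ-pointwise {z +ᶜ -ᶜ z} {0ᶜ} (λ n → ℚ.+-inverseʳ (seq (re z) n)) (λ n → ℚ.+-inverseʳ (seq (im z) n)))
          ; ⁻¹-cong = λ {z} {w} (r , i) → -ᴿ-cong {re z} {re w} r , -ᴿ-cong {im z} {im w} i
          }
        ; comm = λ z w → ≈ᶜ-pointwise {z +ᶜ w} {w +ᶜ z}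
            (λ n → ℚ.+-comm (seq (re z) n) (seq (re w) n)) (λ n → ℚ.+-comm (seq (im z) n) (seq (im w) n))
        }
      ; *-cong = λ {z} {z′} {w} {w′} → *ᶜ-cong {z} {z′} {w} {w′}
      ; *-assoc = λ z w v → ≈ᶜ-pointwise {(z *ᶜ w) *ᶜ v} {z *ᶜ (w *ᶜ v)}
          (λ n → solveℚ 6 (λ a b c d e f →
              (a :* c :+ :- (b :* d)) :* e :+ :- ((a :* d :+ b :* c) :* f) :=
              a :* (c :* e :+ :- (d :* f)) :+ :- (b :* (c :* f :+ d :* e)))
            ≡.refl (seq (re z) n) (seq (im z) n) (seq (re w) n) (seq (im w) n) (seq (re v) n) (seq (im v) n))
          (λ n → solveℚ 6 (λ a b c d e f →
              (a :* c :+ :- (b :* d)) :* f :+ (a :* d :+ b :* c) :* e :=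
              a :* (c :* f :+ d :* e) :+ b :* (c :* e :+ :- (d :* f)))
            ≡.refl (seq (re z) n) (seq (im z) n) (seq (re w) n) (seq (im w) n) (seq (re v) n) (seq (im v) n))
      ; *-identity =
          (λ z → ≈ᶜ-pointwise {1ᶜ *ᶜ z} {z}
            (λ n → solveℚ 2 (λ a b → con 1ℚ :* a :+ :- (con 0ℚ :* b) := a) ≡.refl (seq (re z) n) (seq (im z) n))
            (λ n → solveℚ 2 (λ a b → con 1ℚ :* b :+ con 0ℚ :* a := b) ≡.refl (seq (re z) n) (seq (im z) n))) ,
          (λ z → ≈ᶜ-pointwise {z *ᶜ 1ᶜ} {z}
            (λ n → solveℚ 2 (λ a b → a :* con 1ℚ :+ :- (b :* con 0ℚ) := a) ≡.refl (seq (re z) n) (seq (im z) n))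
            (λ n → solveℚ 2 (λ a b → a :* con 0ℚ :+ b :* con 1ℚ := b) ≡.refl (seq (re z) n) (seq (im z) n)))
      ; distrib =
          (λ z w v → ≈ᶜ-pointwise {z *ᶜ (w +ᶜ v)} {z *ᶜ w +ᶜ z *ᶜ v}
            (λ n → solveℚ 6 (λ a b c d e f →
                a :* (c :+ e) :+ :- (b :* (d :+ f)) := (a :* c :+ :- (b :* d)) :+ (a :* e :+ :- (b :* f)))
              ≡.refl (seq (re z) n) (seq (im z) n) (seq (re w) n) (seq (im w) n) (seq (re v) n) (seq (im v) n))
            (λ n → solveℚ 6 (λ a b c d e f →
                a :* (d :+ f) :+ b :* (c :+ e) := (a :* d :+ b :* c) :+ (a :* f :+ b :* e))
              ≡.refl (seq (re z) n) (seq (im z) n) (seq (re w) n) (seq (im w) n) (seq (re v) n) (seq (im v) n))) ,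
          (λ z w v → ≈ᶜ-pointwise {(w +ᶜ v) *ᶜ z} {w *ᶜ z +ᶜ v *ᶜ z}
            (λ n → solveℚ 6 (λ a b c d e f →
                (c :+ e) :* a :+ :- ((d :+ f) :* b) := (c :* a :+ :- (d :* b)) :+ (e :* a :+ :- (f :* b)))
              ≡.refl (seq (re z) n) (seq (im z) n) (seq (re w) n) (seq (im w) n) (seq (re v) n) (seq (im v) n))
            (λ n → solveℚ 6 (λ a b c d e f →
                (c :+ e) :* b :+ (d :+ f) :* a := (c :* b :+ d :* a) :+ (e :* b :+ f :* a))
              ≡.refl (seq (re z) n) (seq (im z) n) (seq (re w) n) (seq (im w) n) (seq (re v) n) (seq (im v) n)))
      }
    ; *-comm = λ z w → ≈ᶜ-pointwise {z *ᶜ w} {w *ᶜ z}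
        (λ n → solveℚ 4 (λ a b c d → a :* c :+ :- (b :* d) := c :* a :+ :- (d :* b))
          ≡.refl (seq (re z) n) (seq (im z) n) (seq (re w) n) (seq (im w) n))
        (λ n → solveℚ 4 (λ a b c d → a :* d :+ b :* c := c :* b :+ d :* a)
          ≡.refl (seq (re z) n) (seq (im z) n) (seq (re w) n) (seq (im w) n))
    }

ℂ-commutativeRing : CommutativeRing 0ℓ 0ℓ
ℂ-commutativeRing = record { isCommutativeRing = ℂ-isCommutativeRing }

conjugate : ℂ → ℂ
conjugate z = re z +i (-ᴿ im z)

norm² : ℂ → ℕ → ℚ
norm² z n = seq (re z) n ℚ.* seq (re z) n ℚ.+ seq (im z) n ℚ.* seq (im z) n

norm²-null : ∀ z → Null (norm² z) → z ≈ᶜ 0ᶜ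
norm²-null z ∣z∣²→0 =
  null⇒≈0 (re z) (null-sum-of-squares (seq (re z)) (seq (im z)) ∣z∣²→0) ,
  null⇒≈0 (im z) (null-sum-of-squares (seq (im z)) (seq (re z)) λ ε ε>0 →
    eventually (λ n → subst (λ q → ℚ.∣ q ∣ ℚ.< ε) (ℚ.+-comm (seq (re z) n ℚ.* seq (re z) n) _)) (∣z∣²→0 ε ε>0))

null-resp : ∀ {x y} → (∀ n → x n ≡ y n) → Null x → Null y
null-resp x≡y x→0 ε ε>0 = eventually (λ n → subst (λ q → ℚ.∣ q ∣ ℚ.< ε) (x≡y n)) (x→0 ε ε>0)

-- Multiply z w ≈ 0 by the conjugate of z.
ℂ-*-cancel-≉0 : ∀ {z w} → z *ᶜ w ≈ᶜ 0ᶜ → ¬ z ≈ᶜ 0ᶜ → w ≈ᶜ 0ᶜ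
ℂ-*-cancel-≉0 {z} {w} zw≈0 z≉0 =
  null⇒≈0 (re w) (cancel (re w) (null-resp
    (λ n → solveℚ 4 (λ a b c d → a :* (a :* c :+ :- (b :* d)) :+ :- (:- b :* (a :* d :+ b :* c)) :=
        (a :* a :+ b :* b) :* c)
      ≡.refl (seq (re z) n) (seq (im z) n) (seq (re w) n) (seq (im w) n))
    (≈0⇒null (re z̄zw) (proj₁ z̄zw≈0)))) ,
  null⇒≈0 (im w) (cancel (im w) (null-resp
    (λ n → solveℚ 4 (λ a b c d → a :* (a :* d :+ b :* c) :+ :- b :* (a :* c :+ :- (b :* d)) :=
        (a :* a :+ b :* b) :* d)
      ≡.refl (seq (re z) n) (seq (im z) n) (seq (re w) n) (seq (im w) n))
    (≈0⇒null (im z̄zw) (proj₂ z̄zw≈0))))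
  where
  z̄zw = conjugate z *ᶜ (z *ᶜ w)

  z̄zw≈0 : z̄zw ≈ᶜ 0ᶜ
  z̄zw≈0 = trans {z̄zw} {conjugate z *ᶜ 0ᶜ} {0ᶜ} (*-congˡ {conjugate z} {z *ᶜ w} {0ᶜ} zw≈0) (zeroʳ (conjugate z))
    where open CommutativeRing ℂ-commutativeRing

  cancel : ∀ x → Null (λ n → norm² z n ℚ.* seq x n) → Null (seq x)
  cancel x ∣z∣²x→0 = null-cancel (norm² z) (seq x) (cauchy x) ∣z∣²x→0 λ ∣z∣²→0 → z≉0 (norm²-null z ∣z∣²→0)

≈ᴿ0-stable : ∀ x → ¬ ¬ x ≈ᴿ 0ᴿ → x ≈ᴿ 0ᴿ
≈ᴿ0-stable x ¬¬x≈0 = null⇒≈0 x (null-stable (seq x) (cauchy x) λ ¬x→0 → ¬¬x≈0 λ x≈0 → ¬x→0 (≈0⇒null x x≈0))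

open import Algebra.Definitions.RawMonoid ℂᴿ.+-rawMonoid using () renaming (_×_ to _·ᶜ_)

0≤n·1 : ∀ k n → 0ℚ ℚ.≤ seq (re (k ·ᶜ 1ᶜ)) n
0≤n·1 zero    n = ℚ.≤-refl
0≤n·1 (suc k) n = ℚ.+-mono-≤ {0ℚ} {1ℚ} {0ℚ} (ℚ.nonNegative⁻¹ 1ℚ) (0≤n·1 k n)

-- The real part is at least 1 in every term, hence not null.
ℂ-characteristic0 : ∀ k → ¬ suc k ·ᶜ 1ᶜ ≈ᶜ 0ᶜ
ℂ-characteristic0 k (k≈0 , _) = boundedAway⇒¬null
  (1ℚ , ℚ.positive⁻¹ 1ℚ , 0 , λ n _ → ℚ.≤-trans (1≤ n) (ℚ.≤-reflexive (≡.sym (ℚ.0≤p⇒∣p∣≡p (0≤n·1 (suc k) n)))))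
  (≈0⇒null (re (suc k ·ᶜ 1ᶜ)) k≈0)
  where
  1≤ : ∀ n → 1ℚ ℚ.≤ seq (re (suc k ·ᶜ 1ᶜ)) n
  1≤ n = ℚ.≤-trans (ℚ.≤-reflexive (≡.sym (ℚ.+-identityʳ 1ℚ))) (ℚ.+-monoʳ-≤ 1ℚ (0≤n·1 k n))

ℂ-isStableDomain : IsStableDomain ℂ-commutativeRing
ℂ-isStableDomain = record
  { ≈0-stable       = λ {z} ¬¬z≈0 →
      ≈ᴿ0-stable (re z) (λ r≉0 → ¬¬z≈0 λ (r≈0 , _) → r≉0 r≈0) ,
      ≈ᴿ0-stable (im z) (λ i≉0 → ¬¬z≈0 λ (_ , i≈0) → i≉0 i≈0)
  ; *-cancel-≉0     = λ {z} {w} → ℂ-*-cancel-≉0 {z} {w}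
  ; characteristic0 = ℂ-characteristic0
  }

-- Whether α is in the support need not be decided: a coefficient is either eventually
-- small or bounded away from 0, and only in the second case is α ∈ supp g used.
near1⇒nonNegative : ∀ {n d} ε (g : Form n d) → ε <ᴿ 1ᴿ → CoefficientsNear1 ε g → NonNegativeCoefficients g
near1⇒nonNegative ε g (δ , δ>0 , ε+δ<1) (real , near1) α = real α , 0≤
  where
  x = re (coeff g α)

  0<x+η : ∀ {η} → 0ℚ ℚ.< η → ∀ q → ℚ.∣ q ∣ ℚ.< η → 0ℚ ℚ.< q ℚ.+ η
  0<x+η {η} η>0 q ∣q∣<η with ℚ.∣p∣≡p∨∣p∣≡-p q
  ... | inj₁ ∣q∣≡q  = ℚ.+-mono-≤-< {0ℚ} (ℚ.∣p∣≡p⇒0≤p ∣q∣≡q) η>0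
  ... | inj₂ ∣q∣≡-q = subst (ℚ._< q ℚ.+ η) (ℚ.+-inverseʳ q) (ℚ.+-monoʳ-< q (subst (ℚ._< η) ∣q∣≡-q ∣q∣<η))

  0<1-ε : ∀ q → q ℚ.+ δ ℚ.< 1ℚ → 0ℚ ℚ.< 1ℚ ℚ.- q
  0<1-ε q q+δ<1 = subst (ℚ._< 1ℚ ℚ.- q) (ℚ.+-inverseʳ q) (ℚ.+-monoˡ-< (ℚ.- q)
    (ℚ.<-trans (subst (ℚ._< q ℚ.+ δ) (ℚ.+-identityʳ q) (ℚ.+-monoʳ-< q δ>0)) q+δ<1))

  0≤ : 0ᴿ ≤ᴿ x
  0≤ η η>0 with small-or-boundedAway (seq x) (cauchy x) η η>0
  ... | inj₁ small = eventually (λ n → 0<x+η η>0 (seq x n)) small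
  ... | inj₂ away  = eventually₂
          (λ n ε+δ<1 1-ε<x+η → ℚ.<-trans (0<1-ε (seq ε n) ε+δ<1) 1-ε<x+η) ε+δ<1
          (proj₁ (near1 λ (x≈0 , _) → boundedAway⇒¬null away (≈0⇒null x x≈0)) η η>0)

-- Power series over ℂ

module ℂ-LinearForms = LinearForms ℂ-commutativeRing
open ℂ-LinearForms using (linear*; ι)
open Monomials ℂ-commutativeRing using (monomial)
module ℂ-Sums = PowerSums ℂ-commutativeRing ℂ-isStableDomain
open import Algebra.Properties.Semiring.Sum (CommutativeRing.semiring ℂ-commutativeRing) using (sum-cong-≋)
module ℂᶜ = CommutativeRing ℂ-commutativeRing

∑-zero : ∀ {n} (α : Exponent n) F → (∀ β γ → F β γ ≈ᶜ 0ᶜ) → ∑⟨ α ⟩ F ≈ᶜ 0ᶜ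
∑-zero []      F F≈0 = F≈0 [] []
∑-zero (a ∷ α) F F≈0 = ℂ-Sums.sum-zero
  (λ (i : Fin (suc a)) → ∑⟨ α ⟩ λ β γ → F (toℕ i ∷ β) ((a ∸ toℕ i) ∷ γ))
  (λ i → ∑-zero α (λ β γ → F (toℕ i ∷ β) ((a ∸ toℕ i) ∷ γ)) λ β γ → F≈0 (toℕ i ∷ β) ((a ∸ toℕ i) ∷ γ))

*ᶜ-zeroˡ : ∀ z w → z ≈ᶜ 0ᶜ → z *ᶜ w ≈ᶜ 0ᶜ
*ᶜ-zeroˡ z w z≈0 = ℂᶜ.trans {z *ᶜ w} {0ᶜ *ᶜ w} {0ᶜ} (ℂᶜ.*-congʳ {w} {z} {0ᶜ} z≈0) (ℂᶜ.zeroˡ w)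

*ˢ-zeroˡ : ∀ {n} (c f : Series n) → (∀ β → c β ≈ᶜ 0ᶜ) → ∀ α → (c *ˢ f) α ≈ᶜ 0ᶜ
*ˢ-zeroˡ c f c≈0 α = ∑-zero α (λ β γ → c β *ᶜ f γ) λ β γ → *ᶜ-zeroˡ (c β) (f γ) (c≈0 β)

-- The part of the coefficient of `f *ˢ g` at `a ∷ α` in which `f` contributes exponent `i` to the
-- first variable.
convolutionTerm : ∀ {n} (f g : Series (suc n)) a → Exponent n → Fin (suc a) → ℂ
convolutionTerm f g a α i = ((f ∘ (toℕ i ∷_)) *ˢ (g ∘ ((a ∸ toℕ i) ∷_))) α

-- In each variable only the term where `c` contributes exponent 0 survives.
constant-*ˢ : ∀ {n} (c f : Series n) → (∀ β → Vec.sum β ≢ 0 → c β ≈ᶜ 0ᶜ) →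
  ∀ α → (c *ˢ f) α ≈ᶜ c (replicate n 0) *ᶜ f α
constant-*ˢ c f c≈0 []              = ℂᶜ.refl {c [] *ᶜ f []}
constant-*ˢ {suc n} c f c≈0 (a ∷ α) = ℂ-Sums.sum-head (convolutionTerm c f a α) (c (replicate (suc n) 0) *ᶜ f (a ∷ α))
  (constant-*ˢ (c ∘ (0 ∷_)) (f ∘ (a ∷_)) (λ β → c≈0 (0 ∷ β)) α)
  (λ i → *ˢ-zeroˡ (c ∘ (suc (toℕ i) ∷_)) (f ∘ ((a ∸ suc (toℕ i)) ∷_)) (λ β → c≈0 (suc (toℕ i) ∷ β) λ ()) α)

coefficients : ∀ {n} → Series n → Vec ℂ n
coefficients {zero}  l = []
coefficients {suc n} l = l (1 ∷ replicate n 0) ∷ coefficients (l ∘ (0 ∷_))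

-- Split by the exponent of the first variable in `l`: exponent 0 leaves a linear form in the other
-- variables, exponent 1 a constant, and higher exponents nothing.
linear-*ˢ : ∀ {n} (l f : Series n) → (∀ β → Vec.sum β ≢ 1 → l β ≈ᶜ 0ᶜ) →
  ∀ α → (l *ˢ f) α ≈ᶜ linear* (coefficients l) f α
linear-*ˢ l f l≈0 []          = *ᶜ-zeroˡ (l []) (f []) (l≈0 [] λ ())
linear-*ˢ l f l≈0 (zero ∷ α)  = ℂ-Sums.sum-head (convolutionTerm l f 0 α)
  (linear* (coefficients (l ∘ (0 ∷_))) (f ∘ (0 ∷_)) α)
  (linear-*ˢ (l ∘ (0 ∷_)) (f ∘ (0 ∷_)) (λ β → l≈0 (0 ∷ β)) α) (λ ())
linear-*ˢ {suc n} l f l≈0 (suc k ∷ α) = ℂ-Sums.sum-head₂ (convolutionTerm l f (suc k) α)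
  (linear* (coefficients (l ∘ (0 ∷_))) (f ∘ (suc k ∷_)) α) (l (1 ∷ replicate n 0) *ᶜ f (k ∷ α))
  (linear-*ˢ (l ∘ (0 ∷_)) (f ∘ (suc k ∷_)) (λ β → l≈0 (0 ∷ β)) α)
  (constant-*ˢ (l ∘ (1 ∷_)) (f ∘ (k ∷_)) (λ β β≢0 → l≈0 (1 ∷ β) (β≢0 ∘ ℕ.suc-injective)) α)
  (λ i → *ˢ-zeroˡ (l ∘ (suc (suc (toℕ i)) ∷_)) (f ∘ ((k ∸ suc (toℕ i)) ∷_)) (λ β → l≈0 (suc (suc (toℕ i)) ∷ β) λ ()) α)

sumˢ-apply : ∀ {n r} (f : Fin r → Series n) α → sumˢ f α ≡ sumᶜ λ j → f j α
sumˢ-apply {r = zero}  f α = ≡.refl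
sumˢ-apply {r = suc r} f α = cong (f zero α +ᶜ_) (sumˢ-apply (f ∘ suc) α)

waring-coefficient : ∀ {n r} d (ℓ : Fin r → Form n 1) α →
  sumˢ (λ j → coeff (ℓ j) ^ˢ d) α ≈ᶜ
  sumᶜ λ j → ι (multinomial d α) *ᶜ monomial (coefficients (coeff (ℓ j))) α
waring-coefficient {r = r} d ℓ α =
  subst (_≈ᶜ sumᶜ (λ j → ι (multinomial d α) *ᶜ monomial (coefficients (coeff (ℓ j))) α))
    (≡.sym (sumˢ-apply (λ j → coeff (ℓ j) ^ˢ d) α))
    (sum-cong-≋ {r} {λ j → (coeff (ℓ j) ^ˢ d) α} {λ j → ι (multinomial d α) *ᶜ monomial (coefficients (coeff (ℓ j))) α}
      λ j → ℂ-LinearForms.linearPower (coefficients (coeff (ℓ j))) (λ d → coeff (ℓ j) ^ˢ d) (λ _ → ≡.refl)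
        (λ d → linear-*ˢ (coeff (ℓ j)) (coeff (ℓ j) ^ˢ d) (homogeneous (ℓ j))) d α)

-- The support of the elementary symmetric polynomial.

∈-subsets : ∀ {n} (S : Subset n) → S ∈ subsets n
∈-subsets []            = here ≡.refl
∈-subsets (inside ∷ S)  = ∈-++⁺ˡ (∈-map⁺ (inside ∷_) (∈-subsets S))
∈-subsets {suc n} (outside ∷ S) = ∈-++⁺ʳ (List.map (inside ∷_) (subsets n)) (∈-map⁺ (outside ∷_) (∈-subsets S))

indicator≟ : ∀ {n} (α : Exponent n) (S : Subset n) → Dec (indicator S ≡ α)
indicator≟ α S = Vec.≡-dec ℕ._≟_ (indicator S) α

-- Writing a coefficient as a count reduces its being nonzero, in characteristic 0, to the count
-- being positive.
monomials-coefficient : ∀ {n} (Ss : List (Subset n)) α →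
  List.foldr _+ˢ_ 0ˢ (List.map (λ S → x^ indicator S) Ss) α ≈ᶜ ι (List.length (filter (indicator≟ α) Ss))
monomials-coefficient []       α = ℂᶜ.refl {0ᶜ}
monomials-coefficient (S ∷ Ss) α with Vec.≡-dec ℕ._≟_ (indicator S) α
... | yes _ = ℂᶜ.+-congˡ {1ᶜ} {List.foldr _+ˢ_ 0ˢ (List.map (λ S → x^ indicator S) Ss) α}
        {ι (List.length (filter (indicator≟ α) Ss))} (monomials-coefficient Ss α)
... | no _  = ℂᶜ.trans {0ᶜ +ᶜ p} {p} {ι (List.length (filter (indicator≟ α) Ss))}
        (ℂᶜ.+-identityˡ p) (monomials-coefficient Ss α)
  where p = List.foldr _+ˢ_ 0ˢ (List.map (λ S → x^ indicator S) Ss) α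

module _ {n d : ℕ} {α : Exponent n} where

  e-zero : (∀ S → ∣ S ∣ ≡ d → indicator S ≢ α) → e n d α ≈ᶜ 0ᶜ
  e-zero indicator≢ = subst (λ Ss → e n d α ≈ᶜ ι (List.length Ss))
    (filter-none (indicator≟ α) (All.tabulate λ {S} S∈ →
      indicator≢ S (proj₂ (∈-filter⁻ (λ S → ∣ S ∣ ℕ.≟ d) {xs = subsets n} S∈))))
    (monomials-coefficient (filter (λ S → ∣ S ∣ ℕ.≟ d) (subsets n)) α)

  e-nonzero : ∀ S → ∣ S ∣ ≡ d → indicator S ≡ α → ¬ e n d α ≈ᶜ 0ᶜ
  e-nonzero S ∣S∣≡d eq e≈0 = ι>0⇒≉0
    (filter-some (indicator≟ α) (lose (∈-filter⁺ (λ S → ∣ S ∣ ℕ.≟ d) (∈-subsets S) ∣S∣≡d) eq))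
    (ℂᶜ.trans {ι (List.length (filter (indicator≟ α) Ss))} {e n d α} {0ᶜ}
      (ℂᶜ.sym {e n d α} {ι (List.length (filter (indicator≟ α) Ss))} (monomials-coefficient Ss α)) e≈0)
    where
    Ss = filter (λ S → ∣ S ∣ ℕ.≟ d) (subsets n)
    open WaringBound ℂ-commutativeRing ℂ-isStableDomain using (ι>0⇒≉0)

∣S∣≤prefix : ∀ {d k} (S : Subset (d ℕ.+ k)) (β : Vec ℕ d) → indicator S ≡ β ++ replicate k 0 → ∣ S ∣ ≤ d
∣S∣≤prefix {k = k} S [] eq = ℕ.≤-reflexive (≡.trans (≡.sym (sum-indicator S))
  (≡.trans (cong Vec.sum eq) (sum-++-replicate-0 [] k)))
∣S∣≤prefix (inside ∷ S)  (b ∷ β) eq = s≤s (∣S∣≤prefix S β (Vec.∷-injectiveʳ eq))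
∣S∣≤prefix (outside ∷ S) (b ∷ β) eq = ℕ.m≤n⇒m≤1+n (∣S∣≤prefix S β (Vec.∷-injectiveʳ eq))

-- A position missed among the first `d` would leave at most d - 1 elements, by `∣S∣≤prefix`.
full-prefix : ∀ {d k} (S : Subset (d ℕ.+ k)) (β : Vec ℕ d) →
  indicator S ≡ β ++ replicate k 0 → ∣ S ∣ ≡ d → β ≡ replicate d 1
full-prefix S             []      eq _       = ≡.refl
full-prefix (inside ∷ S)  (b ∷ β) eq ∣S∣≡d   =
  cong₂ _∷_ (≡.sym (Vec.∷-injectiveˡ eq)) (full-prefix S β (Vec.∷-injectiveʳ eq) (ℕ.suc-injective ∣S∣≡d))
full-prefix (outside ∷ S) (b ∷ β) eq ∣S∣≡1+d =
  contradiction (∣S∣≤prefix S β (Vec.∷-injectiveʳ eq)) (ℕ.<⇒≱ (ℕ.≤-reflexive (≡.sym ∣S∣≡1+d)))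

prefix : ∀ d k → Subset (d ℕ.+ k)
prefix d k = replicate d inside ++ replicate k outside

indicator-prefix : ∀ d k → indicator (prefix d k) ≡ replicate d 1 ++ replicate k 0
indicator-prefix zero    k = Vec.map-replicate _ outside k
indicator-prefix (suc d) k = cong (1 ∷_) (indicator-prefix d k)

∣prefix∣ : ∀ d k → ∣ prefix d k ∣ ≡ d
∣prefix∣ zero    zero    = ≡.refl
∣prefix∣ zero    (suc k) = ∣prefix∣ zero k
∣prefix∣ (suc d) k       = cong suc (∣prefix∣ d k)

-- The lower bound for complex forms and the chain of minima.

open import Data.Nat.Base using (_^_)

2^[d-1]≤waring : ∀ {m k r} (g : Form (suc m ℕ.+ k) (suc m)) → supp (coeff g) ≐ supp (e (suc m ℕ.+ k) (suc m)) →
  HasWaringDecomposition g r → 2 ^ m ≤ r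
2^[d-1]≤waring {m} {k} {r} g (supp⊆ , supp⊇) (ℓ , g≈) = waring-bound {m} {k} (coefficients ∘ coeff ∘ ℓ) (coeff g)
  (λ α → ℂᶜ.trans {coeff g α} {sumˢ (λ j → coeff (ℓ j) ^ˢ suc m) α}
    {sumᶜ λ j → ι (multinomial (suc m) α) *ᶜ monomial (coefficients (coeff (ℓ j))) α}
    (g≈ α) (waring-coefficient (suc m) ℓ α))
  -- `supp⊆` only refutes that the coefficient is nonzero; stability turns this into its being 0.
  (λ β _ β≢1 → ≈0-stable {coeff g (β ++ replicate k 0)} λ α∈supp → supp⊆ {β ++ replicate k 0} α∈supp
    (e-zero λ S ∣S∣≡d eq → β≢1 (full-prefix S β eq ∣S∣≡d)))
  (supp⊇ {replicate (suc m) 1 ++ replicate k 0}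
    (e-nonzero (prefix (suc m) k) (∣prefix∣ (suc m) k) (indicator-prefix (suc m) k)))
  where
  open WaringBound ℂ-commutativeRing ℂ-isStableDomain using (waring-bound)
  open IsStableDomain ℂ-isStableDomain using (≈0-stable)

theorem28 : ∀ (n d : ℕ) → 1 ≤ d → d ≤ n →
    ∀ (ε : ℝ) → 0ᴿ ≤ᴿ ε → ε <ᴿ 1ᴿ →
    ∀ (a a⁺ aᵋ : ℕ) → IsA n d a → IsA⁺ n d a⁺ → IsAᵋ ε n d aᵋ →
    2 ^ (d ∸ 1) ≤ a × a ≤ a⁺ × a⁺ ≤ aᵋ
theorem28 n (suc m) _ d≤n ε _ ε<1 a a⁺ aᵋ
  ((g , g-supp , g-decomposes , _) , a-least)
  ((g⁺ , g⁺-supp , _ , g⁺-rank) , a⁺-least)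
  ((gᵋ , gᵋ-supp , gᵋ-near1 , gᵋ-rank) , _)
  -- Writing n as `suc m ℕ.+ k` separates the variables kept from the `k` set to 0.
  with k , ≡.refl ← ℕ.m≤n⇒∃[o]m+o≡n d≤n
  = 2^[d-1]≤waring g g-supp g-decomposes ,
    -- A minimiser for one quantity is a candidate for the preceding one; for the last inequality, ε
    -- < 1 makes the coefficients nonnegative.
    a-least a⁺ (g⁺ , g⁺-supp , g⁺-rank) ,
    a⁺-least aᵋ (gᵋ , gᵋ-supp , near1⇒nonNegative ε gᵋ ε<1 gᵋ-near1 , gᵋ-rank)
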